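{- The Hopf algebras $\mathsf{cf}(\mathrm{UT}_\bullet)$ and $\mathsf{scf}(\mathrm{UT}_\bullet)$ are noncommutative and noncocommutative.
   Context: Fix the finite field $\mathbb{F}_q$; $[n]=\{1,\dots,n\}$. $\mathrm{UT}_n$ is the group of $n\times n$ unipotent upper triangular matrices over $\mathbb{F}_q$; $\mathsf{cf}$ denotes complex class functions. Hopf algebra $\mathsf{cf}(\mathrm{UT}_\bullet)=\bigoplus_n\mathsf{cf}(\mathrm{UT}_n)$: for $I\subseteq[n]$, $I^c=[n]\setminus I$, let $\mathrm{UL}_I=\{g\in\mathrm{UT}_n:(g-1_n)_{i,j}\ne0\text{ only if }(i,j)\in I\times I\cup I^c\times I^c\}$, $\mathrm{UR}_I=\{g:(g-1_n)_{i,j}\ne0\text{ only if }(i,j)\in I\times I^c\}$, $\mathrm{UP}_I=\{g:(g-1_n)_{i,j}=0\text{ for }(i,j)\in I^c\times I\}=\mathrm{UL}_I\ltimes\mathrm{UR}_I$ ($\mathrm{UP}_{[i]}=\mathrm{UT}_n$). With $\mathrm{cano}_I:I\to[|I|]$ order-preserving, $\mathrm{UL}_I\cong\mathrm{UT}_{|I|}\times\mathrm{UT}_{|I^c|}$ by relabelling the diagonal blocks, inducing $\mathrm{st}_{(I,I^c)}:\mathsf{cf}(\mathrm{UL}_I)\to\mathsf{cf}(\mathrm{UT}_{|I|})\otimes\mathsf{cf}(\mathrm{UT}_{|I^c|})$. Product $\mu=\bigoplus_{n\ge i\ge0}\mathrm{Inf}^{\mathrm{UT}_n}_{\mathrm{UL}_{[i]}}\circ\mathrm{st}^{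 -1}_{([i],[i]^c)}$ with $\mathrm{Inf}\psi(lr)=\psi(l)$; coproduct $\Delta=\bigoplus_n\sum_{I\subseteq[n]}\mathrm{st}_{(I,I^c)}\circ\mathrm{Def}^{\mathrm{UP}_I}_{\mathrm{UL}_I}\circ\mathrm{Res}^{\mathrm{UT}_n}_{\mathrm{UP}_I}$ with $\mathrm{Def}\psi(g)=\frac1{|\mathrm{UR}_I|}\sum_{x\in\mathrm{UR}_I}\psi(gx)$. A natural unit interval order of $[n]$ is a partial order $\pi\subseteq[n]\times[n]$ with $(i,j)\in\pi\Rightarrow i\le j$ such that for every $(j,k)\in\pi$ with $j\ne k$, all $(i,l)$ with $i\le j$, $k\le l$ lie in $\pi$. For such $\pi$, $\mathrm{UT}(\pi)=\{g\in\mathrm{UT}_n:(g-1_n)_{i,j}\ne0\text{ only if }(i,j)\in\pi\}$, and $\mathsf{scf}(\mathrm{UT}_n)$ is the span of the characters $\mathrm{Ind}^{\mathrm{UT}_n}_{\mathrm{UT}(\pi)}(\mathbb{1})$ over all natural unit interval orders $\pi$ of $[n]$; $\mathsf{scf}(\mathrm{UT}_\bullet)=\bigoplus_n\mathsf{scf}(\mathrm{UT}_n)$ is a sub-Hopf algebra of $\mathsf{cf}(\mathrm{UT}_\bullet)$. -}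

module Defs where

open import Algebra.Bundles using (CommutativeRing)
open import Algebra.Structures using (IsCommutativeRing)
import Algebra.Properties.Group
import Algebra.Properties.Semiring.Sum
open import Data.Bool.Base using (if_then_else_)
open import Data.Fin.Base as Fin using (Fin; zero; suc)
import Data.Fin.Properties as Fin
open import Data.Fin.Subset using (Subset; inside; outside; _∈_; _∉_; ∣_∣; ∁; ⊥)
open import Data.Fin.Subset.Properties using (_∈?_; x∉p⇒x∈∁p; ∉⊥)
open import Data.Integer.Base as ℤ using (+_)
open import Data.List.Base as List using (List; []; _∷_; allFin; upTo; length; mapMaybe; cartesianProductWith)
open import Data.Maybe.Base using (just; nothing)
open import Data.Nat.Base as ℕ using (ℕ; zero; suc; z<s; s<s)
import Data.Nat.Properties as ℕ
open import Data.Product.Base using (∃; _×_; _,_; proj₁; proj₂)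
open import Data.Rational.Base as ℚ using (ℚ; 0ℚ; 1ℚ; ½)
import Data.Rational.Properties as ℚ
open import Data.Rational.Solver using (module +-*-Solver)
open import Data.Sum.Base using (_⊎_; inj₁; inj₂)
open import Data.Vec.Base as Vec using (Vec; []; _∷_; here; there)
import Data.Vec.Properties as Vec
open import Function.Base using (_∘_)
open import Function.Bundles using (_↔_; module Inverse)
open import Level using (0ℓ)
import Level
open import Relation.Binary.Core using (Rel; _⇒_)
open import Relation.Binary.Definitions using (Decidable; DecidableEquality; Transitive)
open import Relation.Binary.PropositionalEquality
open import Relation.Binary.Structures using (IsDecPartialOrder)
open import Relation.Unary using (Pred)
open import Relation.Nullary using (¬_; Dec; yes; no; does; contradiction)
open import Relation.Nullary.Decidable using (_×-dec_; _→-dec_; ¬?; map′)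

------------------------------------------------------------------------
-- Real numbers: Cauchy sequences of rationals, up to null sequences

Vanishing : (ℕ → ℕ → ℚ) → Set
Vanishing d = ∀ ε → 0ℚ ℚ.< ε → ∃ λ N → ∀ m n → N ℕ.≤ m → N ℕ.≤ n → ℚ.∣ d m n ∣ ℚ.< ε

record ℝ : Set where
  no-eta-equality
  field
    seq    : ℕ → ℚ
    cauchy : Vanishing (λ m n → seq m ℚ.- seq n)
open ℝ public

record _≈ʳ_ (x y : ℝ) : Set where
  constructor equal
  field difference : Vanishing (λ n _ → seq x n ℚ.- seq y n)
open _≈ʳ_ public

infix 4 _≈ʳ_

private

  EventuallyBounded : (ℕ → ℕ → ℚ) → Set
  EventuallyBounded c = ∃ λ B → 0ℚ ℚ.< B ×
    ∃ λ N → ∀ m n → N ℕ.≤ m → N ℕ.≤ n → ℚ.∣ c m n ∣ ℚ.< B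

  open +-*-Solver

  abstract

    sub-add : ∀ a b → a ≡ a ℚ.- b ℚ.+ b
    sub-add = solve 2 (λ a b → a := a :- b :+ b) refl

    neg-sub : ∀ a b → ℚ.- (a ℚ.- b) ≡ b ℚ.- a
    neg-sub = solve 2 (λ a b → :- (a :- b) := b :- a) refl

    telescope : ∀ a b c → (a ℚ.- b) ℚ.+ (b ℚ.- c) ≡ a ℚ.- c
    telescope = solve 3 (λ a b c → (a :- b) :+ (b :- c) := a :- c) refl

    sum-difference : ∀ a b c d → (a ℚ.- c) ℚ.+ (b ℚ.- d) ≡ (a ℚ.+ b) ℚ.- (c ℚ.+ d)
    sum-difference = solve 4 (λ a b c d → (a :- c) :+ (b :- d) := (a :+ b) :- (c :+ d)) refl

    product-difference : ∀ a b c d →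
      a ℚ.* (b ℚ.- d) ℚ.+ d ℚ.* (a ℚ.- c) ≡ a ℚ.* b ℚ.- c ℚ.* d
    product-difference =
      solve 4 (λ a b c d → a :* (b :- d) :+ d :* (a :- c) := a :* b :- c :* d) refl

    neg-difference : ∀ a b → ℚ.- (a ℚ.- b) ≡ (ℚ.- a) ℚ.- (ℚ.- b)
    neg-difference = solve 2 (λ a b → :- (a :- b) := (:- a) :- (:- b)) refl

    vanishing-cong : ∀ {d e} → (∀ m n → d m n ≡ e m n) → Vanishing d → Vanishing e
    vanishing-cong eq v ε ε>0 =
      let N , p = v ε ε>0 in
      N , λ m n N≤m N≤n → subst (λ r → ℚ.∣ r ∣ ℚ.< ε) (eq m n) (p m n N≤m N≤n)

    vanishing-0 : ∀ {d} → (∀ m n → d m n ≡ 0ℚ) → Vanishing d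
    vanishing-0 eq ε ε>0 = 0 , λ m n _ _ → subst (λ r → ℚ.∣ r ∣ ℚ.< ε) (sym (eq m n)) ε>0

    scale-pos : ∀ r .{{_ : ℚ.Positive r}} {ε} → 0ℚ ℚ.< ε → 0ℚ ℚ.< r ℚ.* ε
    scale-pos r {ε} ε>0 = subst (ℚ._< r ℚ.* ε) (ℚ.*-zeroʳ r) (ℚ.*-monoʳ-<-pos r ε>0)

    vanishing-+ : ∀ {d e} → Vanishing d → Vanishing e → Vanishing (λ m n → d m n ℚ.+ e m n)
    vanishing-+ {d} {e} v w ε ε>0
      = let N , p = v (½ ℚ.* ε) (scale-pos ½ ε>0)
            M , q = w (½ ℚ.* ε) (scale-pos ½ ε>0)
        in N ℕ.⊔ M , λ m n ≤m ≤n → begin-strict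
          ℚ.∣ d m n ℚ.+ e m n ∣         ≤⟨ ℚ.∣p+q∣≤∣p∣+∣q∣ (d m n) (e m n) ⟩
          ℚ.∣ d m n ∣ ℚ.+ ℚ.∣ e m n ∣
            <⟨ ℚ.+-mono-< (p m n (ℕ.m⊔n≤o⇒m≤o N M ≤m) (ℕ.m⊔n≤o⇒m≤o N M ≤n))
                          (q m n (ℕ.m⊔n≤o⇒n≤o N M ≤m) (ℕ.m⊔n≤o⇒n≤o N M ≤n)) ⟩
          ½ ℚ.* ε ℚ.+ ½ ℚ.* ε           ≡⟨ ℚ.*-distribʳ-+ ε ½ ½ ⟨
          1ℚ ℚ.* ε                      ≡⟨ ℚ.*-identityˡ ε ⟩
          ε                             ∎
      where
      open ℚ.≤-Reasoning

    vanishing-* : ∀ {c d} → EventuallyBounded c → Vanishing d → Vanishing (λ m n → c m n ℚ.* d m n)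
    vanishing-* {c} {d} (B , B>0 , N , p) v ε ε>0 = bound (v (1/B ℚ.* ε) 0<ε/B)
      where
      open ℚ.≤-Reasoning
      instance
        B-pos : ℚ.Positive B
        B-pos = ℚ.positive B>0
        B-nonZero : ℚ.NonZero B
        B-nonZero = ℚ.pos⇒nonZero B
      1/B : ℚ
      1/B = ℚ.1/ B
      0<ε/B : 0ℚ ℚ.< 1/B ℚ.* ε
      0<ε/B = scale-pos 1/B {{ℚ.1/pos⇒pos B}} ε>0
      bound : (∃ λ M → ∀ m n → M ℕ.≤ m → M ℕ.≤ n → ℚ.∣ d m n ∣ ℚ.< 1/B ℚ.* ε) →
              ∃ λ M → ∀ m n → M ℕ.≤ m → M ℕ.≤ n → ℚ.∣ c m n ℚ.* d m n ∣ ℚ.< ε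
      bound (M , q) = N ℕ.⊔ M , λ m n ≤m ≤n → begin-strict
        ℚ.∣ c m n ℚ.* d m n ∣         ≡⟨ ℚ.∣p*q∣≡∣p∣*∣q∣ (c m n) (d m n) ⟩
        ℚ.∣ c m n ∣ ℚ.* ℚ.∣ d m n ∣
          ≤⟨ ℚ.*-monoʳ-≤-nonNeg ℚ.∣ d m n ∣ {{ℚ.∣-∣-nonNeg (d m n)}}
               (ℚ.<⇒≤ (p m n (ℕ.m⊔n≤o⇒m≤o N M ≤m) (ℕ.m⊔n≤o⇒m≤o N M ≤n))) ⟩
        B ℚ.* ℚ.∣ d m n ∣
          <⟨ ℚ.*-monoʳ-<-pos B (q m n (ℕ.m⊔n≤o⇒n≤o N M ≤m) (ℕ.m⊔n≤o⇒n≤o N M ≤n)) ⟩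
        B ℚ.* (1/B ℚ.* ε)             ≡⟨ ℚ.*-assoc B 1/B ε ⟨
        B ℚ.* 1/B ℚ.* ε               ≡⟨ cong (ℚ._* ε) (ℚ.*-inverseʳ B) ⟩
        1ℚ ℚ.* ε                      ≡⟨ ℚ.*-identityˡ ε ⟩
        ε                             ∎

    vanishing-neg : ∀ {d} → Vanishing d → Vanishing (λ m n → ℚ.- d m n)
    vanishing-neg {d} v ε ε>0 =
      let N , p = v ε ε>0 in
      N , λ m n ≤m ≤n → subst (ℚ._< ε) (sym (ℚ.∣-p∣≡∣p∣ (d m n))) (p m n ≤m ≤n)

    bounded : ∀ x → ∃ λ B → 0ℚ ℚ.< B × ∃ λ N → ∀ m → N ℕ.≤ m → ℚ.∣ seq x m ∣ ℚ.< B
    bounded x =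
      let N , p = cauchy x 1ℚ (ℚ.positive⁻¹ 1ℚ) in
      1ℚ ℚ.+ ℚ.∣ seq x N ∣
      , ℚ.<-≤-trans (ℚ.positive⁻¹ 1ℚ)
          (subst (ℚ._≤ 1ℚ ℚ.+ ℚ.∣ seq x N ∣) (ℚ.+-identityʳ 1ℚ)
            (ℚ.+-monoʳ-≤ 1ℚ (ℚ.0≤∣p∣ (seq x N))))
      , N , λ m N≤m → begin-strict
          ℚ.∣ seq x m ∣
            ≡⟨ cong ℚ.∣_∣ (sub-add (seq x m) (seq x N)) ⟩
          ℚ.∣ seq x m ℚ.- seq x N ℚ.+ seq x N ∣
            ≤⟨ ℚ.∣p+q∣≤∣p∣+∣q∣ (seq x m ℚ.- seq x N) (seq x N) ⟩
          ℚ.∣ seq x m ℚ.- seq x N ∣ ℚ.+ ℚ.∣ seq x N ∣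
            <⟨ ℚ.+-monoˡ-< ℚ.∣ seq x N ∣ (p m N N≤m ℕ.≤-refl) ⟩
          1ℚ ℚ.+ ℚ.∣ seq x N ∣ ∎
      where open ℚ.≤-Reasoning

    boundedˡ : ∀ x → EventuallyBounded (λ m _ → seq x m)
    boundedˡ x =
      let B , B>0 , N , p = bounded x in B , B>0 , N , λ m _ ≤m _ → p m ≤m

    boundedʳ : ∀ x → EventuallyBounded (λ _ n → seq x n)
    boundedʳ x =
      let B , B>0 , N , p = bounded x in B , B>0 , N , λ _ n _ ≤n → p n ≤n

fromℚ : ℚ → ℝ
fromℚ r .seq _  = r
fromℚ r .cauchy = vanishing-0 (λ _ _ → ℚ.+-inverseʳ r)

_+ʳ_ _*ʳ_ : ℝ → ℝ → ℝ
(x +ʳ y) .seq n  = seq x n ℚ.+ seq y n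
(x +ʳ y) .cauchy = vanishing-cong
  (λ m n → sum-difference (seq x m) (seq y m) (seq x n) (seq y n))
  (vanishing-+ (cauchy x) (cauchy y))
(x *ʳ y) .seq n  = seq x n ℚ.* seq y n
(x *ʳ y) .cauchy = vanishing-cong
  (λ m n → product-difference (seq x m) (seq y m) (seq x n) (seq y n))
  (vanishing-+ (vanishing-* (boundedˡ x) (cauchy y)) (vanishing-* (boundedʳ y) (cauchy x)))

-ʳ_ : ℝ → ℝ
(-ʳ x) .seq n  = ℚ.- seq x n
(-ʳ x) .cauchy = vanishing-cong (λ m n → neg-difference (seq x m) (seq x n)) (vanishing-neg (cauchy x))

abstract

  pointwise : ∀ {x y} → (∀ n → seq x n ≡ seq y n) → x ≈ʳ y
  pointwise {x} eq = equal (vanishing-0 λ n _ →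
    trans (cong (λ r → seq x n ℚ.- r) (sym (eq n))) (ℚ.+-inverseʳ (seq x n)))

  ≈ʳ-sym : ∀ {x y} → x ≈ʳ y → y ≈ʳ x
  ≈ʳ-sym {x} {y} (equal v) = equal (vanishing-cong
    (λ n _ → neg-sub (seq x n) (seq y n))
    (vanishing-neg v))

  ≈ʳ-trans : ∀ {x y z} → x ≈ʳ y → y ≈ʳ z → x ≈ʳ z
  ≈ʳ-trans {x} {y} {z} (equal v) (equal w) = equal (vanishing-cong
    (λ n _ → telescope (seq x n) (seq y n) (seq z n))
    (vanishing-+ v w))

  +ʳ-cong : ∀ {x y u v} → x ≈ʳ y → u ≈ʳ v → (x +ʳ u) ≈ʳ (y +ʳ v)
  +ʳ-cong {x} {y} {u} {v} (equal p) (equal q) = equal (vanishing-cong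
    (λ n _ → sum-difference (seq x n) (seq u n) (seq y n) (seq v n))
    (vanishing-+ p q))

  *ʳ-cong : ∀ {x y u v} → x ≈ʳ y → u ≈ʳ v → (x *ʳ u) ≈ʳ (y *ʳ v)
  *ʳ-cong {x} {y} {u} {v} (equal p) (equal q) = equal (vanishing-cong
    (λ n _ → product-difference (seq x n) (seq u n) (seq y n) (seq v n))
    (vanishing-+ (vanishing-* (boundedˡ x) q) (vanishing-* (boundedˡ v) p)))

  -ʳ-cong : ∀ {x y} → x ≈ʳ y → (-ʳ x) ≈ʳ (-ʳ y)
  -ʳ-cong {x} {y} (equal p) = equal (vanishing-cong
    (λ n _ → neg-difference (seq x n) (seq y n)) (vanishing-neg p))

ℝ-isCommutativeRing : IsCommutativeRing _≈ʳ_ _+ʳ_ _*ʳ_ -ʳ_ (fromℚ 0ℚ) (fromℚ 1ℚ)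
ℝ-isCommutativeRing = record
  { isRing = record
    { +-isAbelianGroup = record
      { isGroup = record
        { isMonoid = record
          { isSemigroup = record
            { isMagma = record
              { isEquivalence = record
                { refl = pointwise (λ _ → refl) ; sym = ≈ʳ-sym ; trans = ≈ʳ-trans }
              ; ∙-cong = +ʳ-cong
              }
            ; assoc = λ x y z → pointwise λ n → ℚ.+-assoc (seq x n) (seq y n) (seq z n)
            }
          ; identity = (λ x → pointwise λ n → ℚ.+-identityˡ (seq x n))
                     , (λ x → pointwise λ n → ℚ.+-identityʳ (seq x n))
          }
        ; inverse = (λ x → pointwise λ n → ℚ.+-inverseˡ (seq x n))
                  , (λ x → pointwise λ n → ℚ.+-inverseʳ (seq x n))
        ; ⁻¹-cong = -ʳ-cong
        }
      ; comm = λ x y → pointwise λ n → ℚ.+-comm (seq x n) (seq y n)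
      }
    ; *-cong = *ʳ-cong
    ; *-assoc = λ x y z → pointwise λ n → ℚ.*-assoc (seq x n) (seq y n) (seq z n)
    ; *-identity = (λ x → pointwise λ n → ℚ.*-identityˡ (seq x n))
                 , (λ x → pointwise λ n → ℚ.*-identityʳ (seq x n))
    ; distrib = (λ x y z → pointwise λ n → ℚ.*-distribˡ-+ (seq x n) (seq y n) (seq z n))
              , (λ x y z → pointwise λ n → ℚ.*-distribʳ-+ (seq x n) (seq y n) (seq z n))
    }
  ; *-comm = λ x y → pointwise λ n → ℚ.*-comm (seq x n) (seq y n)
  }

ℝ-commutativeRing : CommutativeRing 0ℓ 0ℓ
ℝ-commutativeRing = record { isCommutativeRing = ℝ-isCommutativeRing }

------------------------------------------------------------------------
-- Complex numbers

record ℂ : Set where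
  no-eta-equality
  field re im : ℝ
open ℂ public

record _≈ᶜ_ (z w : ℂ) : Set where
  constructor _,ᶜ_
  field
    re≈ : re z ≈ʳ re w
    im≈ : im z ≈ʳ im w

infix  4 _≈ᶜ_
infixr 4 _,ᶜ_

_+ᶜ_ _*ᶜ_ : ℂ → ℂ → ℂ
(z +ᶜ w) .re = re z +ʳ re w
(z +ᶜ w) .im = im z +ʳ im w
(z *ᶜ w) .re = (re z *ʳ re w) +ʳ (-ʳ (im z *ʳ im w))
(z *ᶜ w) .im = (re z *ʳ im w) +ʳ (im z *ʳ re w)

-ᶜ_ : ℂ → ℂ
(-ᶜ z) .re = -ʳ re z
(-ᶜ z) .im = -ʳ im z

rational : ℚ → ℂ
rational r .re = fromℚ r
rational r .im = fromℚ 0ℚ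

private

  module R = IsCommutativeRing ℝ-isCommutativeRing

  abstract

    assoc-re : ∀ a b c d e f →
      (a ℚ.* c ℚ.+ ℚ.- (b ℚ.* d)) ℚ.* e ℚ.+ ℚ.- ((a ℚ.* d ℚ.+ b ℚ.* c) ℚ.* f)
        ≡ a ℚ.* (c ℚ.* e ℚ.+ ℚ.- (d ℚ.* f)) ℚ.+ ℚ.- (b ℚ.* (c ℚ.* f ℚ.+ d ℚ.* e))
    assoc-re = solve 6 (λ a b c d e f →
      (a :* c :+ :- (b :* d)) :* e :+ :- ((a :* d :+ b :* c) :* f)
        := a :* (c :* e :+ :- (d :* f)) :+ :- (b :* (c :* f :+ d :* e))) refl

    assoc-im : ∀ a b c d e f →
      (a ℚ.* c ℚ.+ ℚ.- (b ℚ.* d)) ℚ.* f ℚ.+ (a ℚ.* d ℚ.+ b ℚ.* c) ℚ.* e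
        ≡ a ℚ.* (c ℚ.* f ℚ.+ d ℚ.* e) ℚ.+ b ℚ.* (c ℚ.* e ℚ.+ ℚ.- (d ℚ.* f))
    assoc-im = solve 6 (λ a b c d e f →
      (a :* c :+ :- (b :* d)) :* f :+ (a :* d :+ b :* c) :* e
        := a :* (c :* f :+ d :* e) :+ b :* (c :* e :+ :- (d :* f))) refl

    comm-re : ∀ a b c d → a ℚ.* c ℚ.+ ℚ.- (b ℚ.* d) ≡ c ℚ.* a ℚ.+ ℚ.- (d ℚ.* b)
    comm-re = solve 4 (λ a b c d → a :* c :+ :- (b :* d) := c :* a :+ :- (d :* b)) refl

    comm-im : ∀ a b c d → a ℚ.* d ℚ.+ b ℚ.* c ≡ c ℚ.* b ℚ.+ d ℚ.* a
    comm-im = solve 4 (λ a b c d → a :* d :+ b :* c := c :* b :+ d :* a) refl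

    identity-re : ∀ a b → 1ℚ ℚ.* a ℚ.+ ℚ.- (0ℚ ℚ.* b) ≡ a
    identity-re = solve 2 (λ a b → con 1ℚ :* a :+ :- (con 0ℚ :* b) := a) refl

    identity-im : ∀ a b → 1ℚ ℚ.* b ℚ.+ 0ℚ ℚ.* a ≡ b
    identity-im = solve 2 (λ a b → con 1ℚ :* b :+ con 0ℚ :* a := b) refl

    distrib-re : ∀ a b c d e f →
      a ℚ.* (c ℚ.+ e) ℚ.+ ℚ.- (b ℚ.* (d ℚ.+ f))
        ≡ (a ℚ.* c ℚ.+ ℚ.- (b ℚ.* d)) ℚ.+ (a ℚ.* e ℚ.+ ℚ.- (b ℚ.* f))
    distrib-re = solve 6 (λ a b c d e f →
      a :* (c :+ e) :+ :- (b :* (d :+ f))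
        := (a :* c :+ :- (b :* d)) :+ (a :* e :+ :- (b :* f))) refl

    distrib-im : ∀ a b c d e f →
      a ℚ.* (d ℚ.+ f) ℚ.+ b ℚ.* (c ℚ.+ e)
        ≡ (a ℚ.* d ℚ.+ b ℚ.* c) ℚ.+ (a ℚ.* f ℚ.+ b ℚ.* e)
    distrib-im = solve 6 (λ a b c d e f →
      a :* (d :+ f) :+ b :* (c :+ e)
        := (a :* d :+ b :* c) :+ (a :* f :+ b :* e)) refl

    ≈ᶜ-trans : ∀ {x y z} → x ≈ᶜ y → y ≈ᶜ z → x ≈ᶜ z
    ≈ᶜ-trans (p ,ᶜ q) (r ,ᶜ s) = R.trans p r ,ᶜ R.trans q s

    +ᶜ-cong : ∀ {x y u v} → x ≈ᶜ y → u ≈ᶜ v → (x +ᶜ u) ≈ᶜ (y +ᶜ v)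
    +ᶜ-cong (p ,ᶜ q) (r ,ᶜ s) = R.+-cong p r ,ᶜ R.+-cong q s

    *ᶜ-cong : ∀ {x y u v} → x ≈ᶜ y → u ≈ᶜ v → (x *ᶜ u) ≈ᶜ (y *ᶜ v)
    *ᶜ-cong (p ,ᶜ q) (r ,ᶜ s) =
      R.+-cong (R.*-cong p r) (R.-‿cong (R.*-cong q s)) ,ᶜ R.+-cong (R.*-cong p s) (R.*-cong q r)

    *ᶜ-assoc : ∀ x y z → ((x *ᶜ y) *ᶜ z) ≈ᶜ (x *ᶜ (y *ᶜ z))
    *ᶜ-assoc x y z = let a = re x; b = im x; c = re y; d = im y; e = re z; f = im z in
      pointwise (λ n → assoc-re (seq a n) (seq b n) (seq c n) (seq d n) (seq e n) (seq f n)) ,ᶜ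
      pointwise (λ n → assoc-im (seq a n) (seq b n) (seq c n) (seq d n) (seq e n) (seq f n))

    *ᶜ-comm : ∀ x y → (x *ᶜ y) ≈ᶜ (y *ᶜ x)
    *ᶜ-comm x y = let a = re x; b = im x; c = re y; d = im y in
      pointwise (λ n → comm-re (seq a n) (seq b n) (seq c n) (seq d n)) ,ᶜ
      pointwise (λ n → comm-im (seq a n) (seq b n) (seq c n) (seq d n))

    *ᶜ-identityˡ : ∀ x → (rational 1ℚ *ᶜ x) ≈ᶜ x
    *ᶜ-identityˡ x = let a = re x; b = im x in
      pointwise (λ n → identity-re (seq a n) (seq b n)) ,ᶜ
      pointwise (λ n → identity-im (seq a n) (seq b n))

    *ᶜ-distribˡ : ∀ x y z → (x *ᶜ (y +ᶜ z)) ≈ᶜ ((x *ᶜ y) +ᶜ (x *ᶜ z))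
    *ᶜ-distribˡ x y z = let a = re x; b = im x; c = re y; d = im y; e = re z; f = im z in
      pointwise (λ n → distrib-re (seq a n) (seq b n) (seq c n) (seq d n) (seq e n) (seq f n)) ,ᶜ
      pointwise (λ n → distrib-im (seq a n) (seq b n) (seq c n) (seq d n) (seq e n) (seq f n))

    *ᶜ-distribʳ : ∀ x y z → ((y +ᶜ z) *ᶜ x) ≈ᶜ ((y *ᶜ x) +ᶜ (z *ᶜ x))
    *ᶜ-distribʳ x y z = ≈ᶜ-trans (*ᶜ-comm (y +ᶜ z) x)
      (≈ᶜ-trans (*ᶜ-distribˡ x y z) (+ᶜ-cong (*ᶜ-comm x y) (*ᶜ-comm x z)))

ℂ-isCommutativeRing : IsCommutativeRing _≈ᶜ_ _+ᶜ_ _*ᶜ_ -ᶜ_ (rational 0ℚ) (rational 1ℚ)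
ℂ-isCommutativeRing = record
  { isRing = record
    { +-isAbelianGroup = record
      { isGroup = record
        { isMonoid = record
          { isSemigroup = record
            { isMagma = record
              { isEquivalence = record
                { refl  = R.refl ,ᶜ R.refl
                ; sym   = λ (p ,ᶜ q) → R.sym p ,ᶜ R.sym q
                ; trans = ≈ᶜ-trans
                }
              ; ∙-cong = +ᶜ-cong
              }
            ; assoc = λ x y z → R.+-assoc (re x) (re y) (re z) ,ᶜ R.+-assoc (im x) (im y) (im z)
            }
          ; identity = (λ x → R.+-identityˡ (re x) ,ᶜ R.+-identityˡ (im x))
                     , (λ x → R.+-identityʳ (re x) ,ᶜ R.+-identityʳ (im x))
          }
        ; inverse = (λ x → R.-‿inverseˡ (re x) ,ᶜ R.-‿inverseˡ (im x))
                  , (λ x → R.-‿inverseʳ (re x) ,ᶜ R.-‿inverseʳ (im x))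
        ; ⁻¹-cong = λ (p ,ᶜ q) → R.-‿cong p ,ᶜ R.-‿cong q
        }
      ; comm = λ x y → R.+-comm (re x) (re y) ,ᶜ R.+-comm (im x) (im y)
      }
    ; *-cong = *ᶜ-cong
    ; *-assoc = *ᶜ-assoc
    ; *-identity = *ᶜ-identityˡ
                 , (λ x → ≈ᶜ-trans (*ᶜ-comm x (rational 1ℚ)) (*ᶜ-identityˡ x))
    ; distrib = *ᶜ-distribˡ , *ᶜ-distribʳ
    }
  ; *-comm = *ᶜ-comm
  }

ℂ-commutativeRing : CommutativeRing 0ℓ 0ℓ
ℂ-commutativeRing = record { isCommutativeRing = ℂ-isCommutativeRing }

module ℂ-ring = CommutativeRing ℂ-commutativeRing

-- Only used at orders of finite groups, so the value at 0 is irrelevant.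
1/_ : ℕ → ℂ
1/ zero  = rational 0ℚ
1/ suc m = rational (+ 1 ℚ./ suc m)

sumOver : ∀ {a} {A : Set a} → List A → (A → ℂ) → ℂ
sumOver xs f = List.foldr (λ x s → f x +ᶜ s) (rational 0ℚ) xs

------------------------------------------------------------------------
-- Finite fields

record FiniteField : Set₁ where
  infix  4 _≟_
  infixl 6 _+_
  infixl 7 _*_
  field
    Carrier           : Set
    _+_ _*_           : Carrier → Carrier → Carrier
    -_                : Carrier → Carrier
    0# 1#             : Carrier
    isCommutativeRing : IsCommutativeRing _≡_ _+_ _*_ -_ 0# 1#
    1≢0               : 1# ≢ 0#
    invertible        : ∀ x → x ≢ 0# → ∃ λ y → x * y ≡ 1#
    q                 : ℕ
    enumeration       : Fin q ↔ Carrier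

  commutativeRing : CommutativeRing 0ℓ 0ℓ
  commutativeRing = record { isCommutativeRing = isCommutativeRing }

  open CommutativeRing commutativeRing public using (_-_)

  elements : List Carrier
  elements = List.map (Inverse.to enumeration) (allFin q)

  _≟_ : DecidableEquality Carrier
  x ≟ y = map′ from-injective (cong from) (from x Fin.≟ from y)
    where
    open Inverse enumeration
    from-injective : from x ≡ from y → x ≡ y
    from-injective eq = trans (sym (strictlyInverseˡ x)) (trans (cong to eq) (strictlyInverseˡ y))

------------------------------------------------------------------------
-- Subsets of Fin n

allVecs : {A : Set} → List A → ∀ n → List (Vec A n)
allVecs xs zero    = [] ∷ []
allVecs xs (suc n) = cartesianProductWith _∷_ xs (allVecs xs n)

subsets : ∀ n → List (Subset n)
subsets = allVecs (inside ∷ outside ∷ [])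

-- The first k elements of Fin n.
initial : ∀ n → ℕ → Subset n
initial zero    k       = []
initial (suc n) zero    = ⊥
initial (suc n) (suc k) = inside ∷ initial n k

-- The order isomorphism from I to Fin ∣ I ∣, and its inverse.
cano : ∀ {n} {I : Subset n} {i} → i ∈ I → Fin ∣ I ∣
cano {I = inside  ∷ I} here      = zero
cano {I = inside  ∷ I} (there p) = suc (cano p)
cano {I = outside ∷ I} (there p) = cano p

cano⁻¹ : ∀ {n} (I : Subset n) → Fin ∣ I ∣ → Fin n
cano⁻¹ (inside  ∷ I) zero    = zero
cano⁻¹ (inside  ∷ I) (suc a) = suc (cano⁻¹ I a)
cano⁻¹ (outside ∷ I) a       = suc (cano⁻¹ I a)

initial-closed : ∀ {n} k {i j : Fin n} → i Fin.< j → j ∈ initial n k → i ∈ initial n k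
initial-closed {suc n} zero    _         j∈        = contradiction j∈ ∉⊥
initial-closed {suc n} (suc k) {zero}  _         _         = here
initial-closed {suc n} (suc k) {suc i} {suc j} (s<s i<j) (there j∈) =
  there (initial-closed k i<j j∈)

cano-cancel-< : ∀ {n} {I : Subset n} {i j} (p : i ∈ I) (r : j ∈ I) →
  cano p Fin.< cano r → i Fin.< j
cano-cancel-< {I = inside  ∷ I} here      (there r) _       = z<s
cano-cancel-< {I = inside  ∷ I} (there p) (there r) (s<s c) = s<s (cano-cancel-< p r c)
cano-cancel-< {I = outside ∷ I} (there p) (there r) c       = s<s (cano-cancel-< p r c)

cano-injective : ∀ {n} {I : Subset n} {i j} (p : i ∈ I) (r : j ∈ I) → cano p ≡ cano r → i ≡ j
cano-injective {I = inside  ∷ I} here      here      _  = refl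
cano-injective {I = inside  ∷ I} (there p) (there r) eq =
  cong suc (cano-injective p r (Fin.suc-injective eq))
cano-injective {I = outside ∷ I} (there p) (there r) eq = cong suc (cano-injective p r eq)

cano-cong : ∀ {n} {I : Subset n} {i} (p r : i ∈ I) → cano p ≡ cano r
cano-cong {I = inside  ∷ I} here      here      = refl
cano-cong {I = inside  ∷ I} (there p) (there r) = cong suc (cano-cong p r)
cano-cong {I = outside ∷ I} (there p) (there r) = cano-cong p r

cano⁻¹-cancel-< : ∀ {n} (I : Subset n) {a b} → cano⁻¹ I a Fin.< cano⁻¹ I b → a Fin.< b
cano⁻¹-cancel-< (inside  ∷ I) {zero}  {suc b} _       = z<s
cano⁻¹-cancel-< (inside  ∷ I) {suc a} {suc b} (s<s c) = s<s (cano⁻¹-cancel-< I c)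
cano⁻¹-cancel-< (outside ∷ I)                 (s<s c) = cano⁻¹-cancel-< I c

cano⁻¹-injective : ∀ {n} (I : Subset n) {a b} → cano⁻¹ I a ≡ cano⁻¹ I b → a ≡ b
cano⁻¹-injective (inside  ∷ I) {zero}  {zero}  _  = refl
cano⁻¹-injective (inside  ∷ I) {suc a} {suc b} eq =
  cong suc (cano⁻¹-injective I (Fin.suc-injective eq))
cano⁻¹-injective (outside ∷ I) eq = cano⁻¹-injective I (Fin.suc-injective eq)

------------------------------------------------------------------------
-- Natural unit interval orders

record NaturalUnitIntervalOrder (n : ℕ) : Set₁ where
  infix 4 _≼_
  field
    _≼_               : Rel (Fin n) 0ℓ
    isDecPartialOrder : IsDecPartialOrder _≡_ _≼_
    ≼⇒≤               : ∀ {i j} → i ≼ j → i Fin.≤ j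
    unitInterval      : ∀ {i j k l} → j ≼ k → j ≢ k → i Fin.≤ j → k Fin.≤ l → i ≼ l

  open IsDecPartialOrder isDecPartialOrder public using () renaming (_≤?_ to _≼?_)

------------------------------------------------------------------------
-- The Hopf algebras cf(UT) and scf(UT) over a fixed finite field

module Unitriangular (𝔽 : FiniteField) where

  private
    module F = FiniteField 𝔽
    open Algebra.Properties.Semiring.Sum (CommutativeRing.semiring F.commutativeRing)
      using (sum; sum-cong-≗; sum-replicate-zero)

  Mat : ℕ → Set
  Mat n = Vec (Vec F.Carrier n) n

  entry : ∀ {n} → Mat n → Fin n → Fin n → F.Carrier
  entry M i j = Vec.lookup (Vec.lookup M i) j

  matrix : ∀ {n} → (Fin n → Fin n → F.Carrier) → Mat n
  matrix m = Vec.tabulate λ i → Vec.tabulate (m i)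

  δ : ∀ {n} → Fin n → Fin n → F.Carrier
  δ i j = if does (i Fin.≟ j) then F.1# else F.0#

  infixl 7 _⊗_
  _⊗_ : ∀ {n} → Mat n → Mat n → Mat n
  M ⊗ N = matrix λ i j → sum λ k → entry M i k F.* entry N k j

  _≟ᴹ_ : ∀ {n} → DecidableEquality (Mat n)
  _≟ᴹ_ = Vec.≡-dec (Vec.≡-dec F._≟_)

  -- All nonzero entries of M - 1 lie in R.
  Supported : ∀ {n} → Rel (Fin n) 0ℓ → Mat n → Set
  Supported R M = ∀ i j → entry M i j F.- δ i j ≢ F.0# → R i j

  -- All the groups in question are of this form.  The proof is irrelevant, so
  -- that two elements are equal as soon as their matrices are.
  record Pattern {n} (R : Rel (Fin n) 0ℓ) : Set where
    constructor pattern-matrix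
    field
      mat        : Mat n
      .supported : Supported R mat
  open Pattern public

  supported? : ∀ {n} {R : Rel (Fin n) 0ℓ} → Decidable R → ∀ M → Dec (Supported R M)
  supported? R? M = Fin.all? λ i → Fin.all? λ j →
    ¬? (entry M i j F.- δ i j F.≟ F.0#) →-dec R? i j

  members : ∀ {n} {R : Rel (Fin n) 0ℓ} → Decidable R → List (Pattern R)
  members {n} {R} R? = mapMaybe member (allVecs (allVecs F.elements n) n)
    where
    member : Mat n → _
    member M with supported? R? M
    ... | yes s = just (pattern-matrix M s)
    ... | no  _ = nothing

  include : ∀ {n} {R S : Rel (Fin n) 0ℓ} → R ⇒ S → Pattern R → Pattern S
  include R⇒S (pattern-matrix M s) = pattern-matrix M λ i j ne → R⇒S (s i j ne)

  Upper : ∀ n → Rel (Fin n) 0ℓ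
  Upper n i j = i Fin.< j

  Levi Radical Parabolic : ∀ {n} → Subset n → Rel (Fin n) 0ℓ
  Levi      I i j = i Fin.< j × ((i ∈ I × j ∈ I) ⊎ (i ∉ I × j ∉ I))
  Radical   I i j = i Fin.< j × (i ∈ I × j ∉ I)
  Parabolic I i j = i Fin.< j × ¬ (i ∉ I × j ∈ I)

  Order : ∀ {n} → NaturalUnitIntervalOrder n → Rel (Fin n) 0ℓ
  Order π i j = i Fin.< j × i ≼ j
    where open NaturalUnitIntervalOrder π

  UT : ℕ → Set
  UT n = Pattern (Upper n)

  UL UR UP : ∀ {n} → Subset n → Set
  UL I = Pattern (Levi I)
  UR I = Pattern (Radical I)
  UP I = Pattern (Parabolic I)

  radical? : ∀ {n} (I : Subset n) → Decidable (Radical I)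
  radical? I i j = (i Fin.<? j) ×-dec ((i ∈? I) ×-dec ¬? (j ∈? I))

  order? : ∀ {n} (π : NaturalUnitIntervalOrder n) → Decidable (Order π)
  order? π i j = (i Fin.<? j) ×-dec (i ≼? j)
    where open NaturalUnitIntervalOrder π

  parabolic? : ∀ {n} (I : Subset n) → Decidable (Parabolic I)
  parabolic? I i j = (i Fin.<? j) ×-dec ¬? (¬? (i ∈? I) ×-dec (j ∈? I))

  parabolic-trans : ∀ {n} (I : Subset n) → Transitive (Parabolic I)
  parabolic-trans I {j = j} (i<j , p) (j<k , r) = ℕ.<-trans i<j j<k , λ (i∉I , k∈I) →
    case-∈ (j ∈? I) (λ j∈I → p (i∉I , j∈I)) (λ j∉I → r (j∉I , k∈I))
    where
    case-∈ : ∀ {A B : Set} → Dec A → (A → B) → (¬ A → B) → B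
    case-∈ (yes a) f g = f a
    case-∈ (no ¬a) f g = g ¬a

  entry-matrix : ∀ {n} (m : Fin n → Fin n → F.Carrier) i j → entry (matrix m) i j ≡ m i j
  entry-matrix m i j = trans
    (cong (λ row → Vec.lookup row j) (Vec.lookup∘tabulate (λ i → Vec.tabulate (m i)) i))
    (Vec.lookup∘tabulate (m i) j)

  δ-refl : ∀ {n} (i : Fin n) → δ i i ≡ F.1#
  δ-refl i with i Fin.≟ i
  ... | yes _  = refl
  ... | no i≢i = contradiction refl i≢i

  δ-≢ : ∀ {n} {i j : Fin n} → i ≢ j → δ i j ≡ F.0#
  δ-≢ {i = i} {j} i≢j with i Fin.≟ j
  ... | yes i≡j = contradiction i≡j i≢j
  ... | no _    = refl

  δ-injective : ∀ {m n} (e : Fin m → Fin n) → (∀ {a b} → e a ≡ e b → a ≡ b) →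
    ∀ a b → δ (e a) (e b) ≡ δ a b
  δ-injective e inj a b with a Fin.≟ b
  ... | yes refl = δ-refl (e a)
  ... | no a≢b   = δ-≢ (a≢b ∘ inj)

  δ-cano : ∀ {n} {I : Subset n} {i j} (p : i ∈ I) (r : j ∈ I) → δ (cano p) (cano r) ≡ δ i j
  δ-cano {i = i} {j} p r with i Fin.≟ j
  ... | yes refl = trans (cong (δ (cano p)) (cano-cong r p)) (δ-refl (cano p))
  ... | no i≢j   = δ-≢ (i≢j ∘ cano-injective p r)

  module ringF = CommutativeRing F.commutativeRing

  sum-δ : ∀ {n} (i : Fin n) (x : Fin n → F.Carrier) → sum (λ j → δ i j F.* x j) ≡ x i
  sum-δ {suc n} zero x = trans
    (cong₂ F._+_ (ringF.*-identityˡ (x zero))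
      (trans (sum-cong-≗ λ j → ringF.zeroˡ (x (suc j))) (sum-replicate-zero n)))
    (ringF.+-identityʳ (x zero))
  sum-δ (suc i) x = trans
    (cong₂ F._+_ (ringF.zeroˡ (x zero)) (sum-δ i (x ∘ suc)))
    (ringF.+-identityˡ (x (suc i)))

  off-diagonal : ∀ {n} (i j : Fin n) → i ≢ j → F.0# F.- δ i j ≡ F.0#
  off-diagonal i j i≢j = trans (cong (F._-_ F.0#) (δ-≢ i≢j)) (ringF.-‿inverseʳ F.0#)

  x-y≡0⇒x≡y : ∀ {x y} → x F.- y ≡ F.0# → x ≡ y
  x-y≡0⇒x≡y {x} {y} = Algebra.Properties.Group.x∙y⁻¹≈ε⇒x≈y ringF.+-group x y

  unsupported : ∀ {n} {R : Rel (Fin n) 0ℓ} M → Supported R M →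
    ∀ {i j} → ¬ R i j → entry M i j ≡ δ i j
  unsupported M s {i} {j} ¬Rij with entry M i j F.- δ i j F.≟ F.0#
  ... | yes eq = x-y≡0⇒x≡y eq
  ... | no ne  = contradiction (s i j ne) ¬Rij

  ⊗-supported : ∀ {n} {R : Rel (Fin n) 0ℓ} → Decidable R → Transitive R →
    ∀ M N → Supported R M → Supported R N → Supported R (M ⊗ N)
  ⊗-supported {R = R} R? R-trans M N s t i k ne with R? i k
  ... | yes Rik = Rik
  ... | no ¬Rik = contradiction
        (trans (cong (F._- δ i k) entry≡δ) (ringF.-‿inverseʳ (δ i k))) ne
    where
    term : ∀ j → entry M i j F.* entry N j k ≡ δ i j F.* δ j k
    term j with R? i j | R? j k
    ... | no ¬Rij | no ¬Rjk = cong₂ F._*_ (unsupported M s ¬Rij) (unsupported N t ¬Rjk)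
    ... | yes Rij | yes Rjk = contradiction (R-trans Rij Rjk) ¬Rik
    ... | yes Rij | no ¬Rjk = trans
          (cong (entry M i j F.*_) (trans (unsupported N t ¬Rjk) j≢k))
          (trans (ringF.zeroʳ _) (sym (trans (cong (δ i j F.*_) j≢k) (ringF.zeroʳ _))))
          where
          j≢k : δ j k ≡ F.0#
          j≢k = δ-≢ {i = j} {k} λ { refl → ¬Rik Rij }
    ... | no ¬Rij | yes Rjk = trans
          (cong (F._* entry N j k) (trans (unsupported M s ¬Rij) i≢j))
          (trans (ringF.zeroˡ _) (sym (trans (cong (F._* δ j k) i≢j) (ringF.zeroˡ _))))
          where
          i≢j : δ i j ≡ F.0#
          i≢j = δ-≢ {i = i} {j} λ { refl → ¬Rik Rjk }
    entry≡δ : entry (M ⊗ N) i k ≡ δ i k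
    entry≡δ = trans (entry-matrix _ i k) (trans (sum-cong-≗ term) (sum-δ i (λ j → δ j k)))

  block-supported : ∀ {n} (I : Subset n) M → Supported (Upper n) M →
    Supported (Upper ∣ I ∣) (matrix λ a b → entry M (cano⁻¹ I a) (cano⁻¹ I b))
  block-supported I M s a b ne = cano⁻¹-cancel-< I (s _ _ λ eq → ne (trans
    (cong₂ F._-_ (entry-matrix _ a b) (sym (δ-injective (cano⁻¹ I) (cano⁻¹-injective I) a b)))
    eq))

  UL⊆UP : ∀ {n} (I : Subset n) → Levi I ⇒ Parabolic I
  UL⊆UP I (i<j , inj₁ (i∈I , _)) = i<j , λ (i∉I , _) → i∉I i∈I
  UL⊆UP I (i<j , inj₂ (_ , j∉I)) = i<j , λ (_ , j∈I) → j∉I j∈I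

  UR⊆UP : ∀ {n} (I : Subset n) → Radical I ⇒ Parabolic I
  UR⊆UP I (i<j , i∈I , _) = i<j , λ (i∉I , _) → i∉I i∈I

  UP⊆UT : ∀ {n} (I : Subset n) → Parabolic I ⇒ Upper n
  UP⊆UT I = proj₁

  UT⊆UP[_] : ∀ {n} k → Upper n ⇒ Parabolic (initial n k)
  UT⊆UP[ k ] i<j = i<j , λ (i∉ , j∈) → i∉ (initial-closed k i<j j∈)

  _∙_ : ∀ {n} {I : Subset n} → UP I → UP I → UP I
  _∙_ {I = I} (pattern-matrix M s) (pattern-matrix N t) =
    pattern-matrix (M ⊗ N) (⊗-supported (parabolic? I) (parabolic-trans I) M N s t)

  -- Since (A 0; 0 B)(1 C; 0 1) = (A AC; 0 B), the factor l of an element l r of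
  -- UP I, with l in UL I and r in UR I, is obtained by clearing the I × ∁ I block.
  levi : ∀ {n} (I : Subset n) → UP I → UL I
  levi I (pattern-matrix M s) = pattern-matrix (matrix m) (supp s)
    where
    m : Fin _ → Fin _ → F.Carrier
    m i j = if does ((i ∈? I) ×-dec ¬? (j ∈? I)) then F.0# else entry M i j
    lemma : Supported (Parabolic I) M → ∀ i j → m i j F.- δ i j ≢ F.0# → Levi I i j
    lemma s i j ne with i ∈? I | j ∈? I
    ... | yes i∈I | yes j∈I = proj₁ (s i j ne) , inj₁ (i∈I , j∈I)
    ... | no i∉I  | no j∉I  = proj₁ (s i j ne) , inj₂ (i∉I , j∉I)
    ... | no i∉I  | yes j∈I = contradiction (i∉I , j∈I) (proj₂ (s i j ne))
    ... | yes i∈I | no j∉I  = contradiction (off-diagonal i j λ { refl → j∉I i∈I }) ne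
    supp : Supported (Parabolic I) M → Supported (Levi I) (matrix m)
    supp s i j ne = lemma s i j λ eq → ne (trans (cong (F._- δ i j) (entry-matrix m i j)) eq)

  block : ∀ {n} (I : Subset n) → UT n → UT ∣ I ∣
  block I (pattern-matrix M s) = pattern-matrix
    (matrix λ a b → entry M (cano⁻¹ I a) (cano⁻¹ I b)) (block-supported I M s)

  -- The isomorphism UL I ≅ UT ∣ I ∣ × UT ∣ ∁ I ∣ and its inverse.
  blocks : ∀ {n} (I : Subset n) → UL I → UT ∣ I ∣ × UT ∣ ∁ I ∣
  blocks I l = block I g , block (∁ I) g
    where g = include proj₁ l

  glue : ∀ {n} (I : Subset n) → UT ∣ I ∣ → UT ∣ ∁ I ∣ → UL I
  glue I (pattern-matrix M s) (pattern-matrix N t) = pattern-matrix (matrix m) (supp s t)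
    where
    m : Fin _ → Fin _ → F.Carrier
    m i j with i ∈? I | j ∈? I
    ... | yes i∈I | yes j∈I = entry M (cano i∈I) (cano j∈I)
    ... | no i∉I  | no j∉I  = entry N (cano (x∉p⇒x∈∁p i∉I)) (cano (x∉p⇒x∈∁p j∉I))
    ... | _       | _       = F.0#
    lemma : Supported (Upper _) M → Supported (Upper _) N →
      ∀ i j → m i j F.- δ i j ≢ F.0# → Levi I i j
    lemma s t i j ne with i ∈? I | j ∈? I
    ... | yes i∈I | yes j∈I = cano-cancel-< i∈I j∈I (s _ _ λ eq → ne (trans
          (cong (F._-_ _) (sym (δ-cano i∈I j∈I))) eq)) , inj₁ (i∈I , j∈I)
    ... | no i∉I  | no j∉I  = cano-cancel-< i∈∁I j∈∁I (t _ _ λ eq → ne (trans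
          (cong (F._-_ _) (sym (δ-cano i∈∁I j∈∁I))) eq)) , inj₂ (i∉I , j∉I)
          where
          i∈∁I = x∉p⇒x∈∁p i∉I
          j∈∁I = x∉p⇒x∈∁p j∉I
    ... | no i∉I  | yes j∈I = contradiction (off-diagonal i j λ { refl → i∉I j∈I }) ne
    ... | yes i∈I | no j∉I  = contradiction (off-diagonal i j λ { refl → j∉I i∈I }) ne
    supp : Supported (Upper _) M → Supported (Upper _) N → Supported (Levi I) (matrix m)
    supp s t i j ne = lemma s t i j λ eq → ne (trans (cong (F._- δ i j) (entry-matrix m i j)) eq)

  -- The formulas for the structure maps make sense for arbitrary functions, so
  -- membership in cf or scf is a predicate.  A pure tensor of functions on UT a and
  -- UT b is identified with the function (u , v) ↦ f u * g v, and thus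
  -- cf(UT a) ⊗ cf(UT b) with cf(UT a × UT b).

  -- The hypothesis says h = x g x⁻¹.
  IsClassFunction : ∀ {n} → (UT n → ℂ) → Set
  IsClassFunction {n} ψ = ∀ (x g h : UT n) → mat x ⊗ mat g ≡ mat h ⊗ mat x → ψ g ≈ᶜ ψ h

  Res : ∀ {n} (I : Subset n) → (UT n → ℂ) → UP I → ℂ
  Res I ψ = ψ ∘ include (UP⊆UT I)

  Def : ∀ {n} (I : Subset n) → (UP I → ℂ) → UL I → ℂ
  Def I ψ l = (1/ length R) *ᶜ
    sumOver R λ x → ψ (include (UL⊆UP I) l ∙ include (UR⊆UP I) x)
    where R = members (radical? I)

  Inf : ∀ {n} (I : Subset n) → (UL I → ℂ) → UP I → ℂ
  Inf I ψ = ψ ∘ levi I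

  st : ∀ {n} (I : Subset n) → (UL I → ℂ) → UT ∣ I ∣ → UT ∣ ∁ I ∣ → ℂ
  st I ψ u v = ψ (glue I u v)

  st⁻¹ : ∀ {n} (I : Subset n) → (UT ∣ I ∣ → UT ∣ ∁ I ∣ → ℂ) → UL I → ℂ
  st⁻¹ I θ l = let u , v = blocks I l in θ u v

  -- x⁻¹ g x lies in the subgroup precisely when g x = x h for some h in it,
  -- and then h = x⁻¹ g x.
  Ind : ∀ {n} {R : Rel (Fin n) 0ℓ} → Decidable R → (Pattern R → ℂ) → UT n → ℂ
  Ind R? ψ g = (1/ length H) *ᶜ
    sumOver (members Fin._<?_) λ x →
    sumOver H λ h → if does ((mat g ⊗ mat x) ≟ᴹ (mat x ⊗ mat h)) then ψ h else rational 0ℚ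
    where H = members R?

  -- Families of functions on UT n, and on UT a × UT b; the elements of the direct
  -- sums are the finitely supported ones, a condition imposed in cf and scf.
  Graded Bigraded : Set
  Graded   = ∀ n → UT n → ℂ
  Bigraded = ∀ a b → UT a → UT b → ℂ

  infix 4 _≈_ _≈₂_
  _≈_ : Rel Graded 0ℓ
  f ≈ g = ∀ n x → f n x ≈ᶜ g n x

  _≈₂_ : Rel Bigraded 0ℓ
  θ ≈₂ η = ∀ a b u v → θ a b u v ≈ᶜ η a b u v

  -- The summand of bidegree (c , d).
  inject : ∀ {c d} → (UT c → UT d → ℂ) → Bigraded
  inject {c} {d} θ a b u v with a ℕ.≟ c | b ℕ.≟ d
  ... | yes refl | yes refl = θ u v
  ... | _        | _        = rational 0ℚ

  _⊠_ : Graded → Graded → Bigraded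
  (f ⊠ g) a b u v = f a u *ᶜ g b v

  μ : Bigraded → Graded
  μ θ n x = sumOver (upTo (suc n)) λ i →
    let I = initial n i in
    Inf I (st⁻¹ I (θ ∣ I ∣ ∣ ∁ I ∣)) (include UT⊆UP[ i ] x)

  _·_ : Graded → Graded → Graded
  f · g = μ (f ⊠ g)

  -- The terms in bidegree (a , b) of the coproduct come from degree a + b.
  Δ : Graded → Bigraded
  Δ f a b u v = sumOver (subsets (a ℕ.+ b)) λ I →
    inject (st I (Def I (Res I (f (a ℕ.+ b))))) a b u v

  swap : Bigraded → Bigraded
  swap θ a b u v = θ b a v u

  FinitelySupported : Graded → Set
  FinitelySupported f = ∃ λ N → ∀ n → N ℕ.≤ n → ∀ x → f n x ≈ᶜ rational 0ℚ

  cf : Pred Graded 0ℓ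
  cf f = FinitelySupported f × ∀ n → IsClassFunction (f n)

  χ : ∀ {n} → NaturalUnitIntervalOrder n → UT n → ℂ
  χ π = Ind (order? π) (λ _ → rational 1ℚ)

  InSpan : ∀ {n} → (UT n → ℂ) → Set₁
  InSpan {n} ψ = ∃ λ (cs : List (ℂ × NaturalUnitIntervalOrder n)) →
    ∀ x → ψ x ≈ᶜ sumOver cs λ (c , π) → c *ᶜ χ π x

  scf : Pred Graded (Level.suc 0ℓ)
  scf f = FinitelySupported f × ∀ n → InSpan (f n)

  Commutative Cocommutative : ∀ {ℓ} → Pred Graded ℓ → Set ℓ
  Commutative   S = ∀ f g → S f → S g → f · g ≈ g · f
  Cocommutative S = ∀ f → S f → Δ f ≈₂ swap (Δ f)

{-# OPTIONS --safe #-}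

-- For a natural unit interval order π, UT(π) is normal in UT_n, so its indicator
-- function is a class function and a multiple of the character induced from UT(π).
-- Let Ψ k be this indicator function for the order on [k] whose nontrivial relations
-- are 1 < 3, …, 1 < k.  For Ψ 1 and Ψ 2 the two products in degree 3 evaluate Ψ 2 at
-- the lower right and at the upper left 2 × 2 block, and these differ.  For the
-- coproduct, let v in UT_3 have v₁₂ = 1 as its only nonzero entry above the diagonal.
-- In bidegree (1 , 3) only I = {2} contributes to Δ (Ψ 4) at (1 , v), with the value
-- 1 / |UR_I| = q⁻²; in bidegree (3 , 1) only I = {1 , 3 , 4} contributes at (v , 1),
-- with the value 1 / |UR_I| = q⁻¹.

module Submission where

open import Algebra.Bundles using (CommutativeRing)
import Algebra.Properties.AbelianGroup
import Algebra.Properties.CommutativeSemigroup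
import Algebra.Properties.Ring
import Algebra.Properties.Semiring.Sum
open import Data.Bool.Base using (if_then_else_)
open import Data.Fin.Base as Fin using (Fin; zero; suc)
open import Data.Fin.Induction using (<-wellFounded; >-wellFounded)
import Data.Fin.Properties as Fin
open import Data.Fin.Subset as Subset using (Subset; inside; outside)
open import Data.Fin.Subset.Properties using (_∈?_)
open import Data.Integer.Base as ℤ using (+_)
import Data.Integer.Properties as ℤ
open import Data.List.Base using (List; []; _∷_; length; lookup; mapMaybe)
open import Data.List.Membership.Propositional using (_∈_)
open import Data.List.Membership.Propositional.Properties
  using (∈-lookup; ∈-map⁺; ∈-allFin; ∈-cartesianProductWith⁺)
open import Data.List.Properties using (length-map)
open import Data.List.Relation.Unary.All as All using (All; []; _∷_)
import Data.List.Relation.Unary.All.Properties as All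
open import Data.List.Relation.Unary.AllPairs using ([]; _∷_)
open import Data.List.Relation.Unary.Any as Any using (here; there)
import Data.List.Relation.Unary.Any.Properties as Any
open import Data.List.Relation.Unary.Unique.Propositional using (Unique)
import Data.List.Relation.Unary.Unique.Propositional.Properties as Unique
open import Data.Maybe.Base using (Maybe; just; nothing)
import Data.Maybe.Relation.Unary.All as Maybe
import Data.Maybe.Relation.Unary.Any as MaybeAny
open import Data.Nat.Base as ℕ using (ℕ; zero; suc; NonZero; z≤n; s≤s; z<s)
import Data.Nat.Properties as ℕ
open import Data.Product.Base using (∃; _×_; _,_; proj₁; proj₂)
open import Data.Rational.Base as ℚ using (0ℚ; 1ℚ)
import Data.Rational.Properties as ℚ
open import Data.Rational.Unnormalised.Base as ℚᵘ using (mkℚᵘ; *≡*)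
import Data.Rational.Unnormalised.Properties as ℚᵘ
open import Data.Sum.Base using (_⊎_; inj₁; inj₂)
open import Data.Vec.Base as Vec using (Vec; []; _∷_; here; there)
import Data.Vec.Properties as Vec
open import Defs
open import Function.Base using (_∘_; case_of_)
open import Function.Bundles using (module Inverse)
open import Induction.WellFounded using (Acc; acc)
open import Level using (0ℓ)
open import Relation.Binary.Core using (Rel)
open import Relation.Binary.Definitions using (Decidable)
open import Relation.Binary.PropositionalEquality
open import Relation.Nullary using (¬_; Dec; yes; no; does; contradiction; recompute)
open import Relation.Nullary.Decidable using (_×-dec_; _⊎-dec_; ¬?)
open import Relation.Unary using (Pred)

-- Rational complex numbers and reciprocals of cardinalities.

private module C = ℂ-ring

0ᶜ 1ᶜ : ℂ
0ᶜ = rational 0ℚ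
1ᶜ = rational 1ℚ

-- If `r` and `s` differ, take `ε = ∣ r - s ∣`: the difference of the two constant sequences would
-- have to be smaller than itself in absolute value.
rational-injective : ∀ {r s} → rational r ≈ᶜ rational s → r ≡ s
rational-injective {r} {s} (r≈s ,ᶜ _) with r ℚ.≟ s
... | yes r≡s = r≡s
... | no  r≢s =
  let N , p = difference r≈s ℚ.∣ r ℚ.- s ∣ 0<∣r-s∣ in
  contradiction (p N N ℕ.≤-refl ℕ.≤-refl) (ℚ.<-irrefl refl)
  where
  0<∣r-s∣ : 0ℚ ℚ.< ℚ.∣ r ℚ.- s ∣
  0<∣r-s∣ = ℚ.≰⇒> λ ∣r-s∣≤0 → r≢s (x∙y⁻¹≈ε⇒x≈y r s
    (ℚ.∣p∣≡0⇒p≡0 (r ℚ.- s) (ℚ.≤-antisym ∣r-s∣≤0 (ℚ.0≤∣p∣ (r ℚ.- s)))))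
    where open Algebra.Properties.AbelianGroup ℚ.+-0-abelianGroup

1ᶜ≉0ᶜ : ¬ 1ᶜ ≈ᶜ 0ᶜ
1ᶜ≉0ᶜ eq = case rational-injective eq of λ ()

1/-injective : ∀ {m n} .{{_ : NonZero m}} .{{_ : NonZero n}} → (1/ m) ≈ᶜ (1/ n) → m ≡ n
1/-injective {suc m} {suc n} eq
  with *≡* p ← ℚ.fromℚᵘ-injective {mkℚᵘ (+ 1) m} {mkℚᵘ (+ 1) n} (rational-injective eq) =
  sym (ℤ.+-injective (trans (sym (ℤ.*-identityˡ (+ suc n))) (trans p (ℤ.*-identityˡ (+ suc m)))))

card : ∀ {a} {A : Set a} → List A → ℂ
card xs = sumOver xs (λ _ → 1ᶜ)

private

  suc/1 : ∀ n → 1ℚ ℚ.+ ℚ.fromℚᵘ (mkℚᵘ (+ n) 0) ≡ ℚ.fromℚᵘ (mkℚᵘ (+ suc n) 0)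
  suc/1 n = ℚ.toℚᵘ-injective (begin-equality
    ℚ.toℚᵘ (1ℚ ℚ.+ ℚ.fromℚᵘ n/1)              ≃⟨ ℚ.toℚᵘ-homo-+ 1ℚ (ℚ.fromℚᵘ n/1) ⟩
    ℚ.toℚᵘ 1ℚ ℚᵘ.+ ℚ.toℚᵘ (ℚ.fromℚᵘ n/1)      ≃⟨ ℚᵘ.+-congʳ (ℚ.toℚᵘ 1ℚ) (ℚ.toℚᵘ-fromℚᵘ n/1) ⟩
    ℚ.toℚᵘ 1ℚ ℚᵘ.+ n/1
      ≃⟨ *≡* (cong (λ k → (+ 1 ℤ.+ k) ℤ.* + 1) (ℤ.*-identityʳ (+ n))) ⟩
    mkℚᵘ (+ suc n) 0                          ≃⟨ ℚ.toℚᵘ-fromℚᵘ (mkℚᵘ (+ suc n) 0) ⟨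
    ℚ.toℚᵘ (ℚ.fromℚᵘ (mkℚᵘ (+ suc n) 0))      ∎)
    where
    open ℚᵘ.≤-Reasoning
    n/1 = mkℚᵘ (+ n) 0

  1/-inverse : ∀ m → (+ 1 ℚ./ suc m) ℚ.* (+ suc m ℚ./ 1) ≡ 1ℚ
  1/-inverse m = ℚ.toℚᵘ-injective (begin-equality
    ℚ.toℚᵘ (ℚ.fromℚᵘ x ℚ.* ℚ.fromℚᵘ y)                ≃⟨ ℚ.toℚᵘ-homo-* (ℚ.fromℚᵘ x) (ℚ.fromℚᵘ y) ⟩
    ℚ.toℚᵘ (ℚ.fromℚᵘ x) ℚᵘ.* ℚ.toℚᵘ (ℚ.fromℚᵘ y)      ≃⟨ ℚᵘ.*-cong (ℚ.toℚᵘ-fromℚᵘ x) (ℚ.toℚᵘ-fromℚᵘ y) ⟩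
    x ℚᵘ.* y                                          ≃⟨ ℚᵘ.*-inverseˡ y ⟩
    ℚ.toℚᵘ 1ℚ                                         ∎)
    where
    open ℚᵘ.≤-Reasoning
    x = mkℚᵘ (+ 1) m
    y = mkℚᵘ (+ suc m) 0

  card≈length : ∀ {a} {A : Set a} (xs : List A) → card xs ≈ᶜ rational (+ length xs ℚ./ 1)
  card≈length []       = C.refl
  card≈length (x ∷ xs) = C.trans (C.+-congˡ {1ᶜ} (card≈length xs))
    (pointwise (λ _ → suc/1 (length xs)) ,ᶜ pointwise (λ _ → refl))

-- The list has to be nonempty, since `1/ zero` is 0.
1/length*card≈1 : ∀ {a} {A : Set a} (xs : List A) .{{_ : NonZero (length xs)}} →
  (1/ length xs) *ᶜ card xs ≈ᶜ 1ᶜ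
1/length*card≈1 xs@(_ ∷ ys) = C.trans (C.*-congˡ {1/ length xs} (card≈length xs))
  (pointwise (λ _ → trans (cong (ℚ._+ 0ℚ) (1/-inverse (length ys))) (ℚ.+-identityʳ 1ℚ))
  ,ᶜ pointwise (λ _ → cong₂ ℚ._+_ (ℚ.*-zeroʳ (+ 1 ℚ./ length xs)) (ℚ.*-zeroˡ (+ length xs ℚ./ 1))))

-- Finite sums and lists without repetition.

module _ {a} {A : Set a} where

  sumOver-cong : ∀ {F G : A → ℂ} xs → (∀ x → F x ≈ᶜ G x) → sumOver xs F ≈ᶜ sumOver xs G
  sumOver-cong []       F≈G = C.refl
  sumOver-cong (x ∷ xs) F≈G = C.+-cong (F≈G x) (sumOver-cong xs F≈G)

  sumOver-zero : ∀ {F : A → ℂ} {xs} → All (λ x → F x ≈ᶜ 0ᶜ) xs → sumOver xs F ≈ᶜ 0ᶜ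
  sumOver-zero []           = C.refl
  sumOver-zero (F≈0 ∷ rest) = C.trans (C.+-cong F≈0 (sumOver-zero rest)) (C.+-identityˡ 0ᶜ)

  -- Evaluates the sums in `Ind`, `Def`, `μ` and `Δ` in which one term survives; uniqueness ensures
  -- that it is counted once.
  sumOver-single : ∀ {F : A → ℂ} {xs x} → Unique xs → x ∈ xs →
    (∀ y → y ≢ x → F y ≈ᶜ 0ᶜ) → sumOver xs F ≈ᶜ F x
  sumOver-single {F} {x = x} (x∉ ∷ _) (here refl) zero-off = C.trans
    (C.+-congˡ {F x} (sumOver-zero (All.map (λ x≢y → zero-off _ (x≢y ∘ sym)) x∉)))
    (C.+-identityʳ (F x))
  sumOver-single {F} {x = x} (y∉ ∷ u) (there x∈) zero-off = C.trans
    (C.+-cong (zero-off _ (All.lookup y∉ x∈)) (sumOver-single u x∈ zero-off))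
    (C.+-identityˡ (F x))

  lookup-injective : ∀ {xs : List A} → Unique xs → ∀ i j → lookup xs i ≡ lookup xs j → i ≡ j
  lookup-injective (_  ∷ _) zero    zero    _  = refl
  lookup-injective (x∉ ∷ _) zero    (suc j) eq = contradiction eq (All.lookup x∉ (∈-lookup j))
  lookup-injective (x∉ ∷ _) (suc i) zero    eq = contradiction (sym eq) (All.lookup x∉ (∈-lookup i))
  lookup-injective (_  ∷ u) (suc i) (suc j) eq = cong suc (lookup-injective u i j eq)

  -- Pigeonhole: sending a position in `xs` to a position of the same element in `ys` is injective.
  unique-⊆⇒length≤ : ∀ {xs ys : List A} → Unique xs → (∀ {x} → x ∈ xs → x ∈ ys) →
    length xs ℕ.≤ length ys
  unique-⊆⇒length≤ {xs} {ys} u xs⊆ys = Fin.injective⇒≤ λ {i} {j} eq →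
    lookup-injective u i j (trans (found i) (trans (cong (lookup ys) eq) (sym (found j))))
    where
    found : ∀ i → lookup xs i ≡ lookup ys (Any.index (xs⊆ys (∈-lookup i)))
    found i = Any.lookup-index (xs⊆ys (∈-lookup i))

∈⇒nonZero-length : ∀ {a} {A : Set a} {x : A} {xs} → x ∈ xs → NonZero (length xs)
∈⇒nonZero-length (here _)  = _
∈⇒nonZero-length (there _) = _

-- Whenever `f x` is defined, `g` recovers `x` from it, so distinct arguments cannot produce the
-- same value.
unique-mapMaybe : ∀ {A B : Set} {f : A → Maybe B} (g : B → A) →
  (∀ x → Maybe.All (λ b → g b ≡ x) (f x)) →
  ∀ {xs} → Unique xs → Unique (mapMaybe f xs)
unique-mapMaybe         g inv {[]}     []       = []
unique-mapMaybe {f = f} g inv {x ∷ xs} (x∉ ∷ u) with f x | inv x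
... | nothing | _               = unique-mapMaybe g inv u
... | just b  | Maybe.just refl = All.mapMaybe⁺ (All.map⁺ (All.map off x∉)) ∷ unique-mapMaybe g inv u
  where
  off : ∀ {y} → x ≢ y → Maybe.All (b ≢_) (f y)
  off {y} x≢y = Maybe.map (λ gb≡y b≡b′ → x≢y (trans (cong g b≡b′) gb≡y)) (inv y)

module _ {A : Set} {xs : List A} where

  unique-allVecs : Unique xs → ∀ n → Unique (allVecs xs n)
  unique-allVecs u zero    = [] ∷ []
  unique-allVecs u (suc n) = Unique.cartesianProductWith⁺ _∷_ Vec.∷-injective u (unique-allVecs u n)

  ∈-allVecs : (∀ x → x ∈ xs) → ∀ {n} (v : Vec A n) → v ∈ allVecs xs n
  ∈-allVecs x∈ []      = here refl
  ∈-allVecs x∈ (x ∷ v) = ∈-cartesianProductWith⁺ _∷_ (x∈ x) (∈-allVecs x∈ v)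

vec-ext : ∀ {A : Set} {n} {xs ys : Vec A n} → (∀ i → Vec.lookup xs i ≡ Vec.lookup ys i) → xs ≡ ys
vec-ext {xs = xs} {ys} eq =
  trans (sym (Vec.tabulate∘lookup xs)) (trans (Vec.tabulate-cong eq) (Vec.tabulate∘lookup ys))

if-yes : ∀ {P A : Set} (d : Dec P) → P → {a b : A} → (if does d then a else b) ≡ a
if-yes (yes _) _ = refl
if-yes (no ¬p) p = contradiction p ¬p

if-no : ∀ {P A : Set} (d : Dec P) → ¬ P → {a b : A} → (if does d then a else b) ≡ b
if-no (yes p) ¬p = contradiction p ¬p
if-no (no _)  _  = refl

-- Indices start at 0 here. Every nontrivial relation starts at the first element, so an element of
-- its group differs from 1 in the first row only; the pair of indices 0 and 1 is left unrelated.
stair : ∀ n → NaturalUnitIntervalOrder n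
stair n = record
  { _≼_ = _≼_
  ; isDecPartialOrder = record
    { isPartialOrder = record
      { isPreorder = record
        { isEquivalence = isEquivalence
        ; reflexive     = inj₁
        ; trans         = ≼-trans
        }
      ; antisym = ≼-antisym
      }
    ; _≟_  = Fin._≟_
    ; _≤?_ = λ i j → (i Fin.≟ j) ⊎-dec ((Fin.toℕ i ℕ.≟ 0) ×-dec (2 ℕ.≤? Fin.toℕ j))
    }
  ; ≼⇒≤ = λ where
      (inj₁ refl)      → ℕ.≤-refl
      (inj₂ (i≡0 , _)) → subst (ℕ._≤ _) (sym i≡0) z≤n
  ; unitInterval = unitInterval
  }
  where
  _≼_ : Fin n → Fin n → Set
  i ≼ j = i ≡ j ⊎ (Fin.toℕ i ≡ 0 × 2 ℕ.≤ Fin.toℕ j)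
  ≼-trans : ∀ {i j k} → i ≼ j → j ≼ k → i ≼ k
  ≼-trans (inj₁ refl)      j≼k              = j≼k
  ≼-trans (inj₂ i≼j)       (inj₁ refl)      = inj₂ i≼j
  ≼-trans (inj₂ (i≡0 , _)) (inj₂ (_ , 2≤k)) = inj₂ (i≡0 , 2≤k)
  ≼-antisym : ∀ {i j} → i ≼ j → j ≼ i → i ≡ j
  ≼-antisym (inj₁ i≡j)       _                = i≡j
  ≼-antisym (inj₂ _)         (inj₁ j≡i)       = sym j≡i
  ≼-antisym (inj₂ (i≡0 , _)) (inj₂ (_ , 2≤i)) = case subst (2 ℕ.≤_) i≡0 2≤i of λ ()
  unitInterval : ∀ {i j k l} → j ≼ k → j ≢ k → i Fin.≤ j → k Fin.≤ l → i ≼ l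
  unitInterval (inj₁ j≡k)         j≢k _   _   = contradiction j≡k j≢k
  unitInterval (inj₂ (j≡0 , 2≤k)) _   i≤j k≤l =
    inj₂ (ℕ.n≤0⇒n≡0 (subst (_ ℕ.≤_) j≡0 i≤j) , ℕ.≤-trans 2≤k k≤l)

module UnitriangularProperties (𝔽 : FiniteField) where

  open Unitriangular 𝔽
  module F = FiniteField 𝔽
  open Algebra.Properties.Semiring.Sum (CommutativeRing.semiring F.commutativeRing)
    using (sum; sum-cong-≗; sum-replicate-zero)
  open Algebra.Properties.AbelianGroup ringF.+-abelianGroup 
    using (⁻¹-∙-comm; x≈y⇒x∙y⁻¹≈ε; ∙-cancelʳ; //-rightDividesʳ)
  open Algebra.Properties.Ring ringF.ring using (x[y-z]≈xy-xz; [y-z]x≈yx-zx)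
  open Algebra.Properties.CommutativeSemigroup ringF.+-commutativeSemigroup using (interchange)

  -- Matrix arithmetic and pattern groups.

  pattern-≡ : ∀ {n} {R : Rel (Fin n) 0ℓ} {x y : Pattern R} → mat x ≡ mat y → x ≡ y
  pattern-≡ {x = pattern-matrix _ _} {pattern-matrix _ _} refl = refl

  mat-ext : ∀ {n} {M N : Mat n} → (∀ i j → entry M i j ≡ entry N i j) → M ≡ N
  mat-ext eq = vec-ext λ i → vec-ext (eq i)

  sub-self : ∀ x → x F.- x ≡ F.0#
  sub-self = ringF.-‿inverseʳ

  sum-zero : ∀ {n} {f : Fin n → F.Carrier} → (∀ i → f i ≡ F.0#) → sum f ≡ F.0#
  sum-zero {n} f≡0 = trans (sum-cong-≗ f≡0) (sum-replicate-zero n)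

  sum-sub : ∀ {n} (f g : Fin n → F.Carrier) → sum (λ i → f i F.- g i) ≡ sum f F.- sum g
  sum-sub {zero}  f g = sym (sub-self F.0#)
  sum-sub {suc n} f g = trans (cong (F._+_ _) (sum-sub (f ∘ suc) (g ∘ suc)))
    (trans (interchange _ _ _ _) (cong (F._+_ _) (⁻¹-∙-comm _ _)))

  δ-sym : ∀ {n} (i j : Fin n) → δ i j ≡ δ j i
  δ-sym i j with i Fin.≟ j
  ... | yes refl = sym (δ-refl i)
  ... | no i≢j   = sym (δ-≢ (i≢j ∘ sym))

  sum-δʳ : ∀ {n} (x : Fin n → F.Carrier) i → sum (λ j → x j F.* δ j i) ≡ x i
  sum-δʳ x i = trans
    (sum-cong-≗ λ j → trans (ringF.*-comm (x j) (δ j i)) (cong (F._* x j) (δ-sym j i)))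
    (sum-δ i x)

  D : ∀ {n} → Mat n → Fin n → Fin n → F.Carrier
  D M i j = entry M i j F.- δ i j

  -- This is M (N - 1) = M N - M. With its mirror image below it turns statements about products
  -- into statements about `D`, where support conditions live.
  sum-*D : ∀ {n} (M N : Mat n) i j →
    sum (λ k → entry M i k F.* D N k j) ≡ entry (M ⊗ N) i j F.- entry M i j
  sum-*D M N i j = trans
    (sum-cong-≗ λ k → x[y-z]≈xy-xz (entry M i k) (entry N k j) (δ k j))
    (trans (sum-sub (λ k → entry M i k F.* entry N k j) (λ k → entry M i k F.* δ k j))
      (cong₂ F._-_ (sym (entry-matrix _ i j)) (sum-δʳ (entry M i) j)))

  sum-D* : ∀ {n} (M N : Mat n) i j →
    sum (λ k → D M i k F.* entry N k j) ≡ entry (M ⊗ N) i j F.- entry N i j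
  sum-D* M N i j = trans
    (sum-cong-≗ λ k → [y-z]x≈yx-zx (entry N k j) (entry M i k) (δ i k))
    (trans (sum-sub (λ k → entry M i k F.* entry N k j) (λ k → δ i k F.* entry N k j))
      (cong₂ F._-_ (sym (entry-matrix _ i j)) (sum-δ i (λ k → entry N k j))))

  -- The stored proof is irrelevant, but the property is decidable, so a usable proof can be
  -- recomputed.
  supported! : ∀ {n} {R : Rel (Fin n) 0ℓ} → Decidable R → (x : Pattern R) → Supported R (mat x)
  supported! R? (pattern-matrix M s) = recompute (supported? R? M) s

  entry≡δ : ∀ {n} {R : Rel (Fin n) 0ℓ} → Decidable R → (x : Pattern R) →
    ∀ {i j} → ¬ R i j → entry (mat x) i j ≡ δ i j
  entry≡δ R? x = unsupported (mat x) (supported! R? x)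

  D≡0⇒supported : ∀ {n} {R : Rel (Fin n) 0ℓ} → Decidable R → ∀ M →
    (∀ i j → ¬ R i j → D M i j ≡ F.0#) → Supported R M
  D≡0⇒supported R? M D≡0 i j ne with R? i j
  ... | yes r = r
  ... | no ¬r = contradiction (D≡0 i j ¬r) ne

  D≡0 : ∀ {n} {R : Rel (Fin n) 0ℓ} M → Supported R M → ∀ {i j} → ¬ R i j → D M i j ≡ F.0#
  D≡0 M s {i} {j} ¬r = x≈y⇒x∙y⁻¹≈ε (unsupported M s ¬r)

  module _ {n} {R : Rel (Fin n) 0ℓ} (R? : Decidable R) where

    fill : (Fin n → Fin n → F.Carrier) → Fin n → Fin n → F.Carrier
    fill w i j = if does (R? i j) then w i j else δ i j

    -- Any `w` is allowed: outside `R` its values are overwritten by those of the identity matrix.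
    fromEntries : (Fin n → Fin n → F.Carrier) → Pattern R
    fromEntries w = pattern-matrix (matrix (fill w)) (D≡0⇒supported R? (matrix (fill w)) λ i j ¬r →
      x≈y⇒x∙y⁻¹≈ε (trans (entry-matrix (fill w) i j) (if-no (R? i j) ¬r {w i j} {δ i j})))

    entry-fromEntries : ∀ w {i j} → R i j → entry (mat (fromEntries w)) i j ≡ w i j
    entry-fromEntries w {i} {j} r = trans (entry-matrix (fill w) i j) (if-yes (R? i j) r)

    one : Pattern R
    one = fromEntries δ

    entry-one : ∀ i j → entry (mat one) i j ≡ δ i j
    entry-one i j with R? i j
    ... | yes r = entry-fromEntries δ r
    ... | no ¬r = entry≡δ R? one ¬r

    private
      -- The local function of members, recovered by unification.
      member : Mat n → Maybe (Pattern R)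
      member = proj₁ unfold
        where
        unfold : ∃ λ f → members R? ≡ mapMaybe f (allVecs (allVecs F.elements n) n)
        unfold = _ , refl

      mat-member : ∀ M → Maybe.All (λ x → mat x ≡ M) (member M)
      mat-member M with supported? R? M
      ... | yes _ = Maybe.just refl
      ... | no  _ = Maybe.nothing

      member-mat : ∀ x → MaybeAny.Any (x ≡_) (member (mat x))
      member-mat x with supported? R? (mat x)
      ... | yes _ = MaybeAny.just refl
      ... | no ¬s = contradiction (supported! R? x) ¬s

      module E = Inverse F.enumeration

      unique-elements : Unique F.elements
      unique-elements = Unique.map⁺
        (λ {i} {j} eq → trans (sym (E.strictlyInverseʳ i))
          (trans (cong E.from eq) (E.strictlyInverseʳ j)))
        (Unique.allFin⁺ F.q)

      ∈-elements : ∀ x → x ∈ F.elements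
      ∈-elements x = subst (_∈ F.elements) (E.strictlyInverseˡ x) (∈-map⁺ E.to (∈-allFin (E.from x)))

    unique-members : Unique (members R?)
    unique-members = unique-mapMaybe mat mat-member
      (unique-allVecs (unique-allVecs unique-elements n) n)

    ∈-members : ∀ x → x ∈ members R?
    ∈-members x = Any.mapMaybe⁺ member _ (Any.map⁺ (Any.map (λ { refl → member-mat x })
      (∈-allVecs (∈-allVecs ∈-elements) (mat x))))

    members-nonZero : NonZero (length (members R?))
    members-nonZero = ∈⇒nonZero-length (∈-members one)

  -- Cancellation of unitriangular factors.

  module _ {n} (x : UT n) where

    private
      e : Fin n → Fin n → F.Carrier
      e = entry (mat x)

    -- Downward induction on `i`: row `i` of `x` is 0 before the diagonal and 1 on it, so the
    -- equation for `k = i` gives `A i` once the later `A l` are known to vanish. The equations for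
    -- all `k` from `i` on feed the induction.
    cancelˡ : ∀ (A : Fin n → F.Carrier) i →
      (∀ k → i Fin.≤ k → sum (λ l → e k l F.* A l) ≡ F.0#) → A i ≡ F.0#
    cancelˡ A i eq = go i (>-wellFounded i) eq
      where
      go : ∀ i → Acc Fin._>_ i → (∀ k → i Fin.≤ k → sum (λ l → e k l F.* A l) ≡ F.0#) → A i ≡ F.0#
      go i (acc rec) eq = trans (sym (sum-δ i A)) (trans (sum-cong-≗ term) (eq i ℕ.≤-refl))
        where
        term : ∀ l → δ i l F.* A l ≡ e i l F.* A l
        term l with i Fin.<? l
        ... | no i≮l  = cong (F._* A l) (sym (entry≡δ Fin._<?_ x i≮l))
        ... | yes i<l = trans (cong (δ i l F.*_) A≡0)
                (trans (ringF.zeroʳ _) (sym (trans (cong (e i l F.*_) A≡0) (ringF.zeroʳ _))))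
          where
          A≡0 : A l ≡ F.0#
          A≡0 = go l (rec i<l) λ k l≤k → eq k (ℕ.≤-trans (ℕ.<⇒≤ i<l) l≤k)

    -- The mirror image, by upward induction along column `j`.
    cancelʳ : ∀ (A : Fin n → F.Carrier) j →
      (∀ k → k Fin.≤ j → sum (λ l → A l F.* e l k) ≡ F.0#) → A j ≡ F.0#
    cancelʳ A j eq = go j (<-wellFounded j) eq
      where
      go : ∀ j → Acc Fin._<_ j → (∀ k → k Fin.≤ j → sum (λ l → A l F.* e l k) ≡ F.0#) → A j ≡ F.0#
      go j (acc rec) eq = trans (sym (sum-δʳ A j)) (trans (sum-cong-≗ term) (eq j ℕ.≤-refl))
        where
        term : ∀ l → A l F.* δ l j ≡ A l F.* e l j
        term l with l Fin.<? j
        ... | no l≮j  = cong (A l F.*_) (sym (entry≡δ Fin._<?_ x l≮j))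
        ... | yes l<j = trans (cong (F._* δ l j) A≡0)
                (trans (ringF.zeroˡ _) (sym (trans (cong (F._* e l j) A≡0) (ringF.zeroˡ _))))
          where
          A≡0 : A l ≡ F.0#
          A≡0 = go l (rec l<j) λ k k≤l → eq k (ℕ.≤-trans k≤l (ℕ.<⇒≤ l<j))

    -- No inverse of `x` is constructed: each column of M - N is annihilated by `x`, hence zero by
    -- `cancelˡ`.
    ⊗-cancelˡ : ∀ {M N : Mat n} → mat x ⊗ M ≡ mat x ⊗ N → M ≡ N
    ⊗-cancelˡ {M} {N} eq = mat-ext λ i j → x-y≡0⇒x≡y (cancelˡ (λ l → entry M l j F.- entry N l j) i
      λ k _ → begin
        sum (λ l → e k l F.* (entry M l j F.- entry N l j))
          ≡⟨ sum-cong-≗ (λ l → x[y-z]≈xy-xz (e k l) (entry M l j) (entry N l j)) ⟩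
        sum (λ l → e k l F.* entry M l j F.- e k l F.* entry N l j)
          ≡⟨ sum-sub (λ l → e k l F.* entry M l j) (λ l → e k l F.* entry N l j) ⟩
        sum (λ l → e k l F.* entry M l j) F.- sum (λ l → e k l F.* entry N l j)
          ≡⟨ cong₂ F._-_ (entry-matrix _ k j) (entry-matrix _ k j) ⟨
        entry (mat x ⊗ M) k j F.- entry (mat x ⊗ N) k j
          ≡⟨ x≈y⇒x∙y⁻¹≈ε (cong (λ P → entry P k j) eq) ⟩
        F.0# ∎)
      where open ≡-Reasoning

  -- Normality of UT(π) and the span of induced characters.

  module _ {n} (π : NaturalUnitIntervalOrder n) where

    open NaturalUnitIntervalOrder π using (unitInterval)

    private
      R : Rel (Fin n) 0ℓ
      R = Order π

    -- The unit interval condition as closure of the support under moving up and to the right, which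
    -- is what makes UT(π) normal.
    order-up : ∀ {i j k l} → R j k → i Fin.≤ j → k Fin.≤ l → R i l
    order-up (j<k , j≼k) i≤j k≤l =
      ℕ.<-≤-trans (ℕ.≤-<-trans i≤j j<k) k≤l , unitInterval j≼k (Fin.<⇒≢ j<k) i≤j k≤l

    module _ (x : UT n) (g : Mat n) (s : Supported R g) where

      -- In each term either k < i and `x` has entry 0 there, or i ≤ k and a nonzero entry of g - 1
      -- at (k , j) would put (i , j) into `R`.
      sum-*D≡0 : ∀ i j → ¬ R i j → sum (λ k → entry (mat x) i k F.* D g k j) ≡ F.0#
      sum-*D≡0 i j ¬r = sum-zero term
        where
        term : ∀ k → entry (mat x) i k F.* D g k j ≡ F.0#
        term k with k Fin.<? i
        ... | no k≮i  = trans (cong (entry (mat x) i k F.*_)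
                (D≡0 g s λ r → ¬r (order-up r (ℕ.≮⇒≥ k≮i) ℕ.≤-refl))) (ringF.zeroʳ _)
        ... | yes k<i = trans (cong (F._* D g k j)
                (trans (entry≡δ Fin._<?_ x (ℕ.<⇒≯ k<i)) (δ-≢ (Fin.<⇒≢ k<i ∘ sym)))) (ringF.zeroˡ _)

      sum-D*≡0 : ∀ i j → ¬ R i j → sum (λ k → D g i k F.* entry (mat x) k j) ≡ F.0#
      sum-D*≡0 i j ¬r = sum-zero term
        where
        term : ∀ k → D g i k F.* entry (mat x) k j ≡ F.0#
        term k with j Fin.<? k
        ... | no j≮k  = trans (cong (F._* entry (mat x) k j)
                (D≡0 g s λ r → ¬r (order-up r ℕ.≤-refl (ℕ.≮⇒≥ j≮k)))) (ringF.zeroˡ _)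
        ... | yes j<k = trans (cong (D g i k F.*_)
                (trans (entry≡δ Fin._<?_ x (ℕ.<⇒≯ j<k)) (δ-≢ (Fin.<⇒≢ j<k ∘ sym)))) (ringF.zeroʳ _)

    module _ (x : UT n) (g h : Mat n) (gx≡xh : g ⊗ mat x ≡ mat x ⊗ h) where

      private
        D-conjugate : ∀ i j → sum (λ k → D g i k F.* entry (mat x) k j)
                            ≡ sum (λ k → entry (mat x) i k F.* D h k j)
        D-conjugate i j = trans (sum-D* g (mat x) i j) (trans
          (cong (λ M → entry M i j F.- entry (mat x) i j) gx≡xh) (sym (sum-*D (mat x) h i j)))

      -- From (g - 1) x = x (h - 1), whose right side vanishes outside `R`; cancelling `x` on the
      -- right keeps the vanishing because the complement of `R` is closed under moving left.
      conjugate⁻ : Supported R h → Supported R g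
      conjugate⁻ s = D≡0⇒supported (order? π) g λ i j ¬r → cancelʳ x (D g i) j
        λ k k≤j → trans (D-conjugate i k) (sum-*D≡0 x h s i k λ r → ¬r (order-up r ℕ.≤-refl k≤j))

      conjugate⁺ : Supported R g → Supported R h
      conjugate⁺ s = D≡0⇒supported (order? π) h λ i j ¬r → cancelˡ x (λ k → D h k j) i
        λ k i≤k → trans (sym (D-conjugate k j))
          (sum-D*≡0 x g s k j λ r → ¬r (order-up r i≤k ℕ.≤-refl))

    -- Outside `R` both `l` and `l ⊗ x` agree with the identity, so l (x - 1) = l x - l vanishes
    -- there and `l` can be cancelled.
    quotient-supported : ∀ (l : UT n) x →
      Supported R (mat l) → Supported R (mat l ⊗ x) → Supported R x
    quotient-supported l x s t = D≡0⇒supported (order? π) x λ i j ¬r → cancelˡ l (λ k → D x k j) i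
      λ k i≤k → trans (sum-*D (mat l) x k j) (x≈y⇒x∙y⁻¹≈ε (trans
        (unsupported (mat l ⊗ x) t (λ r → ¬r (order-up r i≤k ℕ.≤-refl)))
        (sym (unsupported (mat l) s (λ r → ¬r (order-up r i≤k ℕ.≤-refl))))))

    indicator : UT n → ℂ
    indicator g = if does (supported? (order? π) (mat g)) then 1ᶜ else 0ᶜ

    indicator-∈ : ∀ {g} → Supported R (mat g) → indicator g ≈ᶜ 1ᶜ
    indicator-∈ {g} s = C.reflexive (if-yes (supported? (order? π) (mat g)) s)

    indicator-∉ : ∀ {g} → ¬ Supported R (mat g) → indicator g ≈ᶜ 0ᶜ
    indicator-∉ {g} ¬s = C.reflexive (if-no (supported? (order? π) (mat g)) ¬s)

    indicator-isClassFunction : IsClassFunction indicator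
    indicator-isClassFunction x g h xg≡hx = case supported? (order? π) (mat g) of λ where
      (yes s) → C.trans (indicator-∈ {g} s)
        (C.sym (indicator-∈ {h} (conjugate⁻ x (mat h) (mat g) (sym xg≡hx) s)))
      (no ¬s) → C.trans (indicator-∉ {g} ¬s)
        (C.sym (indicator-∉ {h} (¬s ∘ conjugate⁺ x (mat h) (mat g) (sym xg≡hx))))

    -- Any x⁻¹ g x can be computed without inverting x, as 1 + (g - 1) x, if the first
    -- row is the only nonzero row of g - 1.
    module _ (first-row : ∀ {i j} → R i j → Fin.toℕ i ≡ 0) where

      conjugate : ∀ (x : UT n) g → Supported R g → ∃ λ (h : Pattern R) → g ⊗ mat x ≡ mat x ⊗ mat h
      conjugate x g s = h , mat-ext λ i j →
        ∙-cancelʳ (F.- entry (mat x) i j) (entry (g ⊗ mat x) i j) (entry (mat x ⊗ mat h) i j)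
          (gx-x≡xh-x i j)
        where
        E : Fin n → Fin n → F.Carrier
        E i j = sum (λ k → D g i k F.* entry (mat x) k j)
        h : Pattern R
        h = fromEntries (order? π) (λ i j → E i j F.+ δ i j)
        Dh≡E : ∀ i j → D (mat h) i j ≡ E i j
        Dh≡E i j with order? π i j
        ... | yes r = trans
                (cong (F._- δ i j) (entry-fromEntries (order? π) (λ i j → E i j F.+ δ i j) r))
                (//-rightDividesʳ (δ i j) (E i j))
        ... | no ¬r = trans (D≡0 (mat h) (supported! (order? π) h) ¬r) (sym (sum-D*≡0 x g s i j ¬r))
        -- This gives x E = E: only row 0 of E can be nonzero, and column 0 of `x` is that of the
        -- identity.
        term : ∀ i j k → δ i k F.* E k j ≡ entry (mat x) i k F.* D (mat h) k j
        term i j k with order? π k j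
        ... | yes r = cong₂ F._*_
                (sym (entry≡δ Fin._<?_ x {i} {k}
                  λ i<k → ℕ.n≮0 (subst (Fin.toℕ i ℕ.<_) (first-row r) i<k)))
                (sym (Dh≡E k j))
        ... | no ¬r = trans (cong (δ i k F.*_) (sum-D*≡0 x g s k j ¬r)) (trans (ringF.zeroʳ _)
                (sym (trans
                  (cong (entry (mat x) i k F.*_) (D≡0 (mat h) (supported! (order? π) h) ¬r))
                  (ringF.zeroʳ _))))
        gx-x≡xh-x : ∀ i j → entry (g ⊗ mat x) i j F.- entry (mat x) i j
                          ≡ entry (mat x ⊗ mat h) i j F.- entry (mat x) i j
        gx-x≡xh-x i j = begin
          entry (g ⊗ mat x) i j F.- entry (mat x) i j          ≡⟨ sum-D* g (mat x) i j ⟨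
          E i j                                                ≡⟨ sum-δ i (λ k → E k j) ⟨
          sum (λ k → δ i k F.* E k j)                          ≡⟨ sum-cong-≗ (term i j) ⟩
          sum (λ k → entry (mat x) i k F.* D (mat h) k j)      ≡⟨ sum-*D (mat x) (mat h) i j ⟩
          entry (mat x ⊗ mat h) i j F.- entry (mat x) i j      ∎
          where open ≡-Reasoning

      private
        U = members {n} Fin._<?_
        H = members (order? π)

        inner : UT n → UT n → ℂ
        inner g x = sumOver H λ h → if does ((mat g ⊗ mat x) ≟ᴹ (mat x ⊗ mat h)) then 1ᶜ else 0ᶜ

        -- Existence of a matching `h` is `conjugate`; left cancellation excludes any other.
        inner-∈ : ∀ g → Supported R (mat g) → ∀ x → inner g x ≈ᶜ 1ᶜ
        inner-∈ g s x with h , eq ← conjugate x (mat g) s =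
          C.trans (sumOver-single (unique-members (order? π)) (∈-members (order? π) h)
            λ y y≢h → C.reflexive (if-no ((mat g ⊗ mat x) ≟ᴹ (mat x ⊗ mat y))
              λ eq′ → y≢h (pattern-≡ (⊗-cancelˡ x {mat y} {mat h} (trans (sym eq′) eq)))))
            (C.reflexive (if-yes ((mat g ⊗ mat x) ≟ᴹ (mat x ⊗ mat h)) eq))

        inner-∉ : ∀ g → ¬ Supported R (mat g) → ∀ x → inner g x ≈ᶜ 0ᶜ
        inner-∉ g ¬s x = sumOver-zero (All.universal (λ h → C.reflexive
          (if-no ((mat g ⊗ mat x) ≟ᴹ (mat x ⊗ mat h))
            λ eq → ¬s (conjugate⁻ x (mat g) (mat h) eq (supported! (order? π) h)))) H)

      indicator-inSpan : InSpan indicator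
      indicator-inSpan = (c , π) ∷ [] , λ g → C.trans (indicator≈ g) (C.sym (C.+-identityʳ _))
        where
        open Algebra.Properties.CommutativeSemigroup C.*-commutativeSemigroup
          using () renaming (interchange to *-interchange)
        -- With U and H the two groups, `χ π` is ∣U∣ / ∣H∣ times the indicator; `c` is the
        -- reciprocal of that factor.
        c : ℂ
        c = (1/ length U) *ᶜ card H
        indicator≈ : ∀ g → indicator g ≈ᶜ c *ᶜ χ π g
        indicator≈ g = case supported? (order? π) (mat g) of λ where
            (yes s) → begin
              indicator g                                            ≈⟨ indicator-∈ {g} s ⟩
              1ᶜ                                                     ≈⟨ C.*-identityˡ 1ᶜ ⟨
              1ᶜ *ᶜ 1ᶜ
                ≈⟨ C.*-cong (1/length*card≈1 U {{members-nonZero {n} Fin._<?_}})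
                     (C.trans (C.*-comm (card H) (1/ length H))
                       (1/length*card≈1 H {{members-nonZero (order? π)}})) ⟨
              ((1/ length U) *ᶜ card U) *ᶜ (card H *ᶜ (1/ length H))
                ≈⟨ *-interchange (1/ length U) (card U) (card H) (1/ length H) ⟩
              c *ᶜ (card U *ᶜ (1/ length H))
                ≈⟨ C.*-congˡ {c} (C.*-comm (card U) (1/ length H)) ⟩
              c *ᶜ ((1/ length H) *ᶜ card U)
                ≈⟨ C.*-congˡ {c} (C.*-congˡ {1/ length H} (sumOver-cong U (inner-∈ g s))) ⟨
              c *ᶜ χ π g                                             ∎
            (no ¬s) → begin
              indicator g                      ≈⟨ indicator-∉ {g} ¬s ⟩
              0ᶜ                               ≈⟨ C.zeroʳ c ⟨
              c *ᶜ 0ᶜ                          ≈⟨ C.*-congˡ {c} (C.zeroʳ (1/ length H)) ⟨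
              c *ᶜ ((1/ length H) *ᶜ 0ᶜ)
                ≈⟨ C.*-congˡ {c} (C.*-congˡ {1/ length H}
                     (sumOver-zero (All.universal (inner-∉ g ¬s) U))) ⟨
              c *ᶜ χ π g                       ∎
          where open import Relation.Binary.Reasoning.Setoid C.setoid

  -- Test functions and noncommutativity.

  stair-order : ∀ {n} {i j : Fin n} → Order (stair n) i j → Fin.toℕ i ≡ 0 × 2 ℕ.≤ Fin.toℕ j
  stair-order (i<j , inj₁ refl) = contradiction i<j (ℕ.<-irrefl refl)
  stair-order (_ , inj₂ p)      = p

  ψ : ∀ n → UT n → ℂ
  ψ n = indicator (stair n)

  concentrated : ∀ k → (UT k → ℂ) → Graded
  concentrated k f n x with n ℕ.≟ k
  ... | yes refl = f x
  ... | no _     = 0ᶜ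

  concentrated-finitelySupported : ∀ k f → FinitelySupported (concentrated k f)
  concentrated-finitelySupported k f = suc k , vanishes
    where
    vanishes : ∀ n → k ℕ.< n → ∀ x → concentrated k f n x ≈ᶜ 0ᶜ
    vanishes n k<n x with n ℕ.≟ k
    ... | yes refl = contradiction k<n (ℕ.<-irrefl refl)
    ... | no _     = C.refl

  Ψ : ℕ → Graded
  Ψ k = concentrated k (ψ k)

  Ψ∈cf : ∀ k → cf (Ψ k)
  Ψ∈cf k = concentrated-finitelySupported k (ψ k) , isClassFunction
    where
    isClassFunction : ∀ n → IsClassFunction (Ψ k n)
    isClassFunction n x g h eq with n ℕ.≟ k
    ... | yes refl = indicator-isClassFunction (stair n) x g h eq
    ... | no _     = C.refl

  Ψ∈scf : ∀ k → scf (Ψ k)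
  Ψ∈scf k = concentrated-finitelySupported k (ψ k) , inSpan
    where
    inSpan : ∀ n → InSpan (Ψ k n)
    inSpan n with n ℕ.≟ k
    ... | yes refl = indicator-inSpan (stair n) (proj₁ ∘ stair-order)
    ... | no _     = [] , λ _ → C.refl

  -- Only entries above the diagonal are kept, so the column of ones leaves a single 1, in row 0 and
  -- column 1. For n = 3 this matrix tests both the product and the coproduct.
  spike : ∀ n → UT n
  spike n = fromEntries Fin._<?_ λ _ j → if does (Fin.toℕ j ℕ.≟ 1) then F.1# else F.0#

  diagonal-blocks : ∀ {n} i → UT n →
    UT Subset.∣ initial n i ∣ × UT Subset.∣ Subset.∁ (initial n i) ∣
  diagonal-blocks {n} i x = blocks (initial n i) (levi (initial n i) (include UT⊆UP[ i ] x))

  μ-term : Bigraded → ∀ n → UT n → ℕ → ℂ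
  μ-term θ n x i = let u , v = diagonal-blocks i x in θ _ _ u v

  -- For i other than 1 the left factor has the wrong degree. The lower right 2 × 2 block is the
  -- identity, the only point where `ψ 2` is nonzero.
  Ψ₁·Ψ₂ : (Ψ 1 · Ψ 2) 3 (spike 3) ≈ᶜ 1ᶜ
  Ψ₁·Ψ₂ = C.trans
    (sumOver-single {F = μ-term (Ψ 1 ⊠ Ψ 2) 3 (spike 3)} {x = 1}
        (Unique.upTo⁺ 4) (there (here refl)) λ where
      0                   _   → C.zeroˡ _
      1                   1≢1 → contradiction refl 1≢1
      2                   _   → C.zeroˡ _
      (suc (suc (suc _))) _   → C.zeroˡ _)
    (C.trans
      (C.*-cong (indicator-∈ (stair 1) {proj₁ (diagonal-blocks 1 (spike 3))}
                  λ { zero zero ne → contradiction (sub-self F.1#) ne })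
                (indicator-∈ (stair 2) {proj₂ (diagonal-blocks 1 (spike 3))} λ where
                  zero       zero       ne → contradiction (sub-self F.1#) ne
                  zero       (suc zero) ne → contradiction (sub-self F.0#) ne
                  (suc zero) zero       ne → contradiction (sub-self F.0#) ne
                  (suc zero) (suc zero) ne → contradiction (sub-self F.1#) ne))
      (C.*-identityˡ 1ᶜ))

  Ψ₂·Ψ₁ : (Ψ 2 · Ψ 1) 3 (spike 3) ≈ᶜ 0ᶜ
  Ψ₂·Ψ₁ = C.trans
    (sumOver-single {F = μ-term (Ψ 2 ⊠ Ψ 1) 3 (spike 3)} {x = 2}
        (Unique.upTo⁺ 4) (there (there (here refl))) λ where
      0                   _   → C.zeroˡ _
      1                   _   → C.zeroˡ _
      2                   2≢2 → contradiction refl 2≢2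
      (suc (suc (suc _))) _   → C.zeroˡ _)
    (C.trans
      -- The upper left block keeps the entry 1 at (0 , 1), which is no relation of `stair 2`.
      (C.*-congʳ (indicator-∉ (stair 2) {proj₁ (diagonal-blocks 2 (spike 3))} λ s →
        case stair-order (s zero (suc zero) (F.1≢0 ∘ x-y≡0⇒x≡y)) of λ { (_ , s≤s ()) }))
      (C.zeroˡ _))

  -- Stated for any class of functions containing all `Ψ k`, so that it covers both `cf` and `scf`.
  noncommutative : ∀ {ℓ} {S : Pred Graded ℓ} → (∀ k → S (Ψ k)) → ¬ Commutative S
  noncommutative Ψ∈S comm = 1ᶜ≉0ᶜ
    (C.trans (C.sym Ψ₁·Ψ₂) (C.trans (comm (Ψ 1) (Ψ 2) (Ψ∈S 1) (Ψ∈S 2) 3 (spike 3)) Ψ₂·Ψ₁))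

  -- Deflation of indicators and noncocommutativity.

  levi? : ∀ {n} (I : Subset n) → Decidable (Levi I)
  levi? I i j = (i Fin.<? j) ×-dec
    (((i ∈? I) ×-dec (j ∈? I)) ⊎-dec (¬? (i ∈? I) ×-dec ¬? (j ∈? I)))

  module _ {n} (I : Subset n) (l : UL I) where

    -- Right multiplication by UR_I changes the block I × ∁ I only: a term with `x` nontrivial at (k
    -- , j) has k in I and j outside, which forces i outside I and `l` to vanish at (i , k).
    entry-UL⊗UR : ∀ (x : UR I) {i j} → ¬ (i Subset.∈ I × j Subset.∉ I) →
      entry (mat l ⊗ mat x) i j ≡ entry (mat l) i j
    entry-UL⊗UR x {i} {j} ¬IJ =
      trans (entry-matrix _ i j) (trans (sum-cong-≗ term) (sum-δʳ (entry (mat l) i) j))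
      where
      term : ∀ k → entry (mat l) i k F.* entry (mat x) k j ≡ entry (mat l) i k F.* δ k j
      term k with radical? I k j
      ... | no ¬r                 = cong (entry (mat l) i k F.*_) (entry≡δ (radical? I) x ¬r)
      ... | yes (_ , k∈I , j∉I) = trans (cong (F._* _) l≡0)
              (trans (ringF.zeroˡ _) (sym (trans (cong (F._* _) l≡0) (ringF.zeroˡ _))))
        where
        i∉I : i Subset.∉ I
        i∉I i∈I = ¬IJ (i∈I , j∉I)
        l≡0 : entry (mat l) i k ≡ F.0#
        l≡0 = trans (entry≡δ (levi? I) l λ where
                      (_ , inj₁ (i∈I , _)) → i∉I i∈I
                      (_ , inj₂ (_ , k∉I)) → k∉I k∈I)
                    (δ-≢ {i = i} {k} λ { refl → i∉I k∈I })

    module _ (π : NaturalUnitIntervalOrder n) where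

      private
        product : UR I → UT n
        product x = include (UP⊆UT I) (include (UL⊆UP I) l ∙ include (UR⊆UP I) x)

      -- The forbidden entry survives in every product l x, so every term of the average is 0.
      Def-indicator-∉ : ∀ {i j} → ¬ Order π i j → ¬ (i Subset.∈ I × j Subset.∉ I) →
        entry (mat l) i j ≢ δ i j → Def I (Res I (indicator π)) l ≈ᶜ 0ᶜ
      Def-indicator-∉ {i} {j} ¬ij ¬IJ l≢δ = C.trans
        (C.*-congˡ (sumOver-zero (All.universal term≈0 (members (radical? I)))))
        (C.zeroʳ _)
        where
        term≈0 : ∀ x → indicator π (product x) ≈ᶜ 0ᶜ
        term≈0 x = indicator-∉ π {product x} λ s →
          l≢δ (trans (sym (entry-UL⊗UR x ¬IJ)) (unsupported (mat l ⊗ mat x) s ¬ij))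

      -- If l x lies in UT(π), so does x by `quotient-supported`; UR_I meets UT(π) trivially, so
      -- only x = 1 contributes to the average.
      Def-indicator-∈ : (∀ {i j} → Radical I i j → ¬ Order π i j) → Supported (Order π) (mat l) →
        Def I (Res I (indicator π)) l ≈ᶜ 1/ length (members (radical? I))
      Def-indicator-∈ disjoint s = C.trans (C.*-congˡ sum≈1) (C.*-identityʳ _)
        where
        l⊗1≡l : mat l ⊗ mat (one (radical? I)) ≡ mat l
        l⊗1≡l = mat-ext λ i j → trans (entry-matrix _ i j) (trans
          (sum-cong-≗ λ k → cong (entry (mat l) i k F.*_) (entry-one (radical? I) k j))
          (sum-δʳ (entry (mat l) i) j))
        supported⇒≡one : ∀ y → Supported (Order π) (mat l ⊗ mat y) → y ≡ one (radical? I)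
        supported⇒≡one y t = pattern-≡ (mat-ext λ i j →
          trans (y≡δ i j) (sym (entry-one (radical? I) i j)))
          where
          y≡δ : ∀ i j → entry (mat y) i j ≡ δ i j
          y≡δ i j with radical? I i j
          ... | yes r = unsupported (mat y)
                  (quotient-supported π (include proj₁ l) (mat y) s t) (disjoint r)
          ... | no ¬r = entry≡δ (radical? I) y ¬r
        sum≈1 : sumOver (members (radical? I)) (indicator π ∘ product) ≈ᶜ 1ᶜ
        sum≈1 = C.trans
          (sumOver-single (unique-members (radical? I)) (∈-members (radical? I) (one (radical? I)))
            λ y y≢1 → indicator-∉ π {product y} (y≢1 ∘ supported⇒≡one y))
          (indicator-∈ π {product (one (radical? I))} (subst (Supported (Order π)) (sym l⊗1≡l) s))

  -- The sets {2} and {1 , 3 , 4} of the paper's indexing.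
  I₀ J₀ : Subset 4
  I₀ = outside ∷ inside ∷ outside ∷ outside ∷ []
  J₀ = inside ∷ outside ∷ inside ∷ inside ∷ []

  id₁ : UT 1
  id₁ = one Fin._<?_

  ∈-subsets : ∀ {n} (I : Subset n) → I ∈ subsets n
  ∈-subsets = ∈-allVecs λ { inside → here refl ; outside → there (here refl) }

  unique-subsets : ∀ n → Unique (subsets n)
  unique-subsets = unique-allVecs (((λ ()) ∷ []) ∷ [] ∷ [])

  glue-I₀ : Supported (Order (stair 4)) (mat (glue I₀ id₁ (spike 3)))
  glue-I₀ zero                   zero                   ne = contradiction (sub-self F.1#) ne
  glue-I₀ zero                   (suc zero)             ne = contradiction (sub-self F.0#) ne
  -- The complement of `I₀` has indices 0, 2, 3, so the entry 1 of `spike 3` moves from (0 , 1) to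
  -- (0 , 2), a relation of `stair 4`.
  glue-I₀ zero                   (suc (suc j))          _  = z<s , inj₂ (refl , s≤s (s≤s z≤n))
  glue-I₀ (suc zero)             zero                   ne = contradiction (sub-self F.0#) ne
  glue-I₀ (suc zero)             (suc zero)             ne = contradiction (sub-self F.1#) ne
  glue-I₀ (suc zero)             (suc (suc zero))       ne = contradiction (sub-self F.0#) ne
  glue-I₀ (suc zero)             (suc (suc (suc zero))) ne = contradiction (sub-self F.0#) ne
  glue-I₀ (suc (suc zero))       zero                   ne = contradiction (sub-self F.0#) ne
  glue-I₀ (suc (suc zero))       (suc zero)             ne = contradiction (sub-self F.0#) ne
  glue-I₀ (suc (suc zero))       (suc (suc zero))       ne = contradiction (sub-self F.1#) ne
  glue-I₀ (suc (suc zero))       (suc (suc (suc zero))) ne = contradiction (sub-self F.0#) ne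
  glue-I₀ (suc (suc (suc zero))) zero                   ne = contradiction (sub-self F.0#) ne
  glue-I₀ (suc (suc (suc zero))) (suc zero)             ne = contradiction (sub-self F.0#) ne
  glue-I₀ (suc (suc (suc zero))) (suc (suc zero))       ne = contradiction (sub-self F.0#) ne
  glue-I₀ (suc (suc (suc zero))) (suc (suc (suc zero))) ne = contradiction (sub-self F.1#) ne

  -- Both glued matrices compute to the same one, with a single nonzero entry off the diagonal.
  glue-J₀ : Supported (Order (stair 4)) (mat (glue J₀ (spike 3) id₁))
  glue-J₀ = glue-I₀

  Δ-term : Graded → ∀ a b → UT a → UT b → Subset (a ℕ.+ b) → ℂ
  Δ-term f a b u v I = inject (st I (Def I (Res I (f (a ℕ.+ b))))) a b u v

  ¬0≼1 : ¬ Order (stair 4) zero (suc zero)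
  ¬0≼1 r = case proj₂ (stair-order r) of λ { (s≤s ()) }

  -- Subsets without exactly one element are removed by `inject`. The singletons other than `I₀`
  -- move the entry 1 of `spike 3` to (1 , 2) or (0 , 1), which are not relations.
  Δ₁₃ : Δ (Ψ 4) 1 3 id₁ (spike 3) ≈ᶜ (1/ length (members (radical? I₀)))
  Δ₁₃ = C.trans
    (sumOver-single {F = Δ-term (Ψ 4) 1 3 id₁ (spike 3)}
        (unique-subsets 4) (∈-subsets I₀) λ where
      (inside  ∷ inside  ∷ _       ∷ _       ∷ []) _ → C.refl
      (inside  ∷ outside ∷ inside  ∷ _       ∷ []) _ → C.refl
      (inside  ∷ outside ∷ outside ∷ inside  ∷ []) _ → C.refl
      I@(inside ∷ outside ∷ outside ∷ outside ∷ []) _ →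
        Def-indicator-∉ I (glue I id₁ (spike 3)) (stair 4) {suc zero} {suc (suc zero)}
          (λ r → case proj₁ (stair-order r) of λ ()) (λ { (there () , _) }) F.1≢0
      (outside ∷ inside  ∷ inside  ∷ _       ∷ []) _ → C.refl
      (outside ∷ inside  ∷ outside ∷ inside  ∷ []) _ → C.refl
      (outside ∷ inside  ∷ outside ∷ outside ∷ []) ≢ → contradiction refl ≢
      (outside ∷ outside ∷ inside  ∷ inside  ∷ []) _ → C.refl
      I@(outside ∷ outside ∷ inside ∷ outside ∷ []) _ →
        Def-indicator-∉ I (glue I id₁ (spike 3)) (stair 4) {zero} {suc zero}
          ¬0≼1 (λ { (() , _) }) F.1≢0
      I@(outside ∷ outside ∷ outside ∷ inside ∷ []) _ →
        Def-indicator-∉ I (glue I id₁ (spike 3)) (stair 4) {zero} {suc zero}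
          ¬0≼1 (λ { (() , _) }) F.1≢0
      (outside ∷ outside ∷ outside ∷ outside ∷ []) _ → C.refl)
    (Def-indicator-∈ I₀ (glue I₀ id₁ (spike 3)) (stair 4) disjoint glue-I₀)
    where
    disjoint : ∀ {i j} → Radical I₀ i j → ¬ Order (stair 4) i j
    disjoint {zero}  (_ , () , _)
    -- The radical of `I₀` lives in row 1, the relations of `stair 4` in row 0.
    disjoint {suc i} _ r = case proj₁ (stair-order r) of λ ()

  -- Index 1 is the only one outside `J₀`, and only 0 precedes it; hence UR J₀ has one free entry.
  radical-J₀ : ∀ {i j} → Radical J₀ i j → i ≡ zero × j ≡ suc zero
  radical-J₀ {zero}    {suc zero}             _               = refl , refl
  radical-J₀ {suc _}   {suc zero}             (s≤s () , _)
  radical-J₀ {_}       {zero}                 (() , _)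
  radical-J₀ {_}       {suc (suc zero)}       (_ , _ , 2∉)    = contradiction (there (there here)) 2∉
  radical-J₀ {_}       {suc (suc (suc zero))} (_ , _ , 3∉)    = contradiction (there (there (there here))) 3∉

  -- Now the subsets of size 3 remain. All but `J₀` place the entry 1 at (1 , 2) or (0 , 1), inside
  -- I × I, where deflation cannot remove it.
  Δ₃₁ : Δ (Ψ 4) 3 1 (spike 3) id₁ ≈ᶜ (1/ length (members (radical? J₀)))
  Δ₃₁ = C.trans
    (sumOver-single {F = Δ-term (Ψ 4) 3 1 (spike 3) id₁}
        (unique-subsets 4) (∈-subsets J₀) λ where
      (outside ∷ outside ∷ outside ∷ outside ∷ []) _ → C.refl
      (outside ∷ outside ∷ outside ∷ inside  ∷ []) _ → C.refl
      (outside ∷ outside ∷ inside  ∷ outside ∷ []) _ → C.refl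
      (outside ∷ outside ∷ inside  ∷ inside  ∷ []) _ → C.refl
      (outside ∷ inside  ∷ outside ∷ outside ∷ []) _ → C.refl
      (outside ∷ inside  ∷ outside ∷ inside  ∷ []) _ → C.refl
      (outside ∷ inside  ∷ inside  ∷ outside ∷ []) _ → C.refl
      I@(outside ∷ inside ∷ inside ∷ inside  ∷ []) _ →
        Def-indicator-∉ I (glue I (spike 3) id₁) (stair 4) {suc zero} {suc (suc zero)}
          (λ r → case proj₁ (stair-order r) of λ ()) (λ (_ , 2∉) → 2∉ (there (there here))) F.1≢0
      (inside  ∷ outside ∷ outside ∷ outside ∷ []) _ → C.refl
      (inside  ∷ outside ∷ outside ∷ inside  ∷ []) _ → C.refl
      (inside  ∷ outside ∷ inside  ∷ outside ∷ []) _ → C.refl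
      (inside  ∷ outside ∷ inside  ∷ inside  ∷ []) ≢ → contradiction refl ≢
      (inside  ∷ inside  ∷ outside ∷ outside ∷ []) _ → C.refl
      I@(inside ∷ inside ∷ outside ∷ inside  ∷ []) _ →
        Def-indicator-∉ I (glue I (spike 3) id₁) (stair 4) {zero} {suc zero}
          ¬0≼1 (λ (_ , 1∉) → 1∉ (there here)) F.1≢0
      I@(inside ∷ inside ∷ inside  ∷ outside ∷ []) _ →
        Def-indicator-∉ I (glue I (spike 3) id₁) (stair 4) {zero} {suc zero}
          ¬0≼1 (λ (_ , 1∉) → 1∉ (there here)) F.1≢0
      (inside  ∷ inside  ∷ inside  ∷ inside  ∷ []) _ → C.refl)
    (Def-indicator-∈ J₀ (glue J₀ (spike 3) id₁) (stair 4)
      (λ r → case radical-J₀ r of λ { (refl , refl) → ¬0≼1 }) glue-J₀)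

  -- Respectively q and q²: UR J₀ corresponds to the proper subset of UR I₀ cut out by
  -- the vanishing of the entry in the last column.
  ∣UR-J₀∣<∣UR-I₀∣ : length (members (radical? J₀)) ℕ.< length (members (radical? I₀))
  ∣UR-J₀∣<∣UR-I₀∣ = subst (λ m → suc m ℕ.≤ length (members (radical? I₀)))
    (length-map φ (members (radical? J₀)))
    -- Strictness comes from prepending `e F.0# F.1#`, which is not in the image of `φ`.
    (unique-⊆⇒length≤
      (All.map⁺ (All.universal e≢φ (members (radical? J₀)))
        ∷ Unique.map⁺ φ-injective (unique-members (radical? J₀)))
      λ _ → ∈-members (radical? I₀) _)
    where
    e : F.Carrier → F.Carrier → UR I₀
    e a b = fromEntries (radical? I₀) λ _ j → if does (Fin.toℕ j ℕ.≟ 2) then a else b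
    φ : UR J₀ → UR I₀
    φ x = e (entry (mat x) zero (suc zero)) F.0#
    e≢φ : ∀ x → e F.0# F.1# ≢ φ x
    e≢φ x eq = F.1≢0 (cong (λ y → entry (mat y) (suc zero) (suc (suc (suc zero)))) eq)
    φ-injective : ∀ {x y} → φ x ≡ φ y → x ≡ y
    φ-injective {x} {y} eq = pattern-≡ (mat-ext entry≡)
      where
      entry≡ : ∀ i j → entry (mat x) i j ≡ entry (mat y) i j
      entry≡ i j with radical? J₀ i j
      ... | no ¬r = trans (entry≡δ (radical? J₀) x ¬r) (sym (entry≡δ (radical? J₀) y ¬r))
      ... | yes r with refl , refl ← radical-J₀ r =
        cong (λ z → entry (mat z) (suc zero) (suc (suc zero))) eq

  -- Comparing bidegrees (3 , 1) and (1 , 3) would equate the reciprocals of ∣UR J₀∣ and ∣UR I₀∣.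
  noncocommutative : ∀ {ℓ} {S : Pred Graded ℓ} → (∀ k → S (Ψ k)) → ¬ Cocommutative S
  noncocommutative Ψ∈S cocomm = ℕ.<-irrefl
    (1/-injective {{members-nonZero (radical? J₀)}} {{members-nonZero (radical? I₀)}}
      (C.trans (C.sym Δ₃₁) (C.trans (cocomm (Ψ 4) (Ψ∈S 4) 3 1 (spike 3) id₁) Δ₁₃)))
    ∣UR-J₀∣<∣UR-I₀∣

theorem7p7 : (𝔽 : FiniteField) → let open Unitriangular 𝔽 in
    (¬ Commutative cf × ¬ Cocommutative cf) × (¬ Commutative scf × ¬ Cocommutative scf)
theorem7p7 𝔽 =
  (noncommutative Ψ∈cf , noncocommutative Ψ∈cf) , (noncommutative Ψ∈scf , noncocommutative Ψ∈scf)
  where open UnitriangularProperties 𝔽
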